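{- Let $n\geq 5$ and let $S$ be the set of all $3$-cycles in $S_n$. Let $CAG_n=\mathrm{Cay}(A_n,S)$ be the complete alternating group graph. Then $$\mathrm{Aut}(CAG_n)=(R(A_n)\rtimes \mathrm{Inn}(S_n))\rtimes \mathbb{Z}_2\cong (A_n\rtimes S_n)\rtimes \mathbb{Z}_2,$$ where $R(A_n)$ is the right regular representation of $A_n$, $\mathrm{Inn}(S_n)$ is the inner automorphism group of $S_n$ (acting on $A_n$ by conjugation), and $\mathbb{Z}_2=\langle h\rangle$ with $h$ the map $\alpha\mapsto\alpha^{ -1}$ for all $\alpha\in A_n$.
   Context: For a finite group $\Gamma$ and a subset $T\subseteq\Gamma$ with $e\notin T$ and $T=T^{ -1}$, the Cayley graph $\mathrm{Cay}(\Gamma,T)$ is the undirected graph with vertex set $\Gamma$ and edge set $\{\{\gamma,t\gamma\}\mid \gamma\in\Gamma, t\in T\}$. The right regular representation is $R(\Gamma)=\{r_\gamma: x\mapsto x\gamma\mid\gamma\in\Gamma\}$, a subgroup of the automorphism group of the Cayley graph. $A_n$ and $S_n$ denote the alternating and symmetric groups of degree $n$. -}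

module Defs where

open import Algebra.Bundles using (Group)
open import Algebra.Morphism.Structures using (IsGroupIsomorphism)
import Algebra.Properties.Group as GroupProperties
open import Data.Fin.Base using (Fin)
open import Data.Fin.Permutation as Perm using (Permutation′; transpose; _⟨$⟩ʳ_; _⟨$⟩ˡ_; _∘ₚ_)
import Data.Fin.Permutation.Components as PC
open import Data.Fin.Permutation.Transposition.List using (TranspositionList; eval)
open import Data.Fin.Properties using (_≟_)
open import Data.List.Base using ([]; _∷_; _++_; [_]; length; map; reverse)
open import Data.List.Properties using (length-++; length-map; length-reverse; unfold-reverse)
open import Data.List.Relation.Unary.All as All using (All; []; _∷_)
import Data.List.Relation.Unary.All.Properties as All
open import Data.Nat.Base using (ℕ)
open import Data.Nat.Divisibility using (_∣_; divides; _∣0; ∣m∣n⇒∣m+n)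
open import Data.Parity.Base using (0ℙ; 1ℙ)
import Data.Parity.Properties as Parity
open import Data.Product.Base using (_×_; _,_; proj₁; proj₂; ∃; ∃-syntax; Σ-syntax)
open import Function.Base using (_∘_)
open import Function.Bundles using (Inverse; _⇔_; mk⇔; Equivalence)
import Function.Construct.Composition as Compose
import Function.Construct.Identity as Identity
import Function.Construct.Symmetry as Symmetry
open import Level using (Level; _⊔_; suc; 0ℓ)
open import Relation.Binary.Bundles using (Setoid)
open import Relation.Binary.Core using (Rel)
open import Relation.Binary.Definitions using (Symmetric; Irreflexive; _Respects_; _Respects₂_)
open import Relation.Binary.PropositionalEquality as ≡ using (_≡_; _≢_; refl; cong)
import Relation.Binary.Reasoning.Setoid as SetoidReasoning
open import Relation.Nullary using (Dec; yes; no; contradiction)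
open import Relation.Unary using (Pred; _∈_; _∉_; _⊆_; _≐_; _∩_)

private
  variable
    c ℓ c₁ ℓ₁ c₂ ℓ₂ p q r : Level

infix 4 _≅_

_≅_ : Group c₁ ℓ₁ → Group c₂ ℓ₂ → Set (c₁ ⊔ ℓ₁ ⊔ c₂ ⊔ ℓ₂)
G ≅ H = ∃[ f ] IsGroupIsomorphism (Group.rawGroup G) (Group.rawGroup H) f

module _ (G : Group c ℓ) where
  open Group G

  record IsSubgroup (P : Pred Carrier p) : Set (c ⊔ ℓ ⊔ p) where
    field
      resp      : P Respects _≈_
      ε-closed  : ε ∈ P
      ∙-closed  : ∀ {x y} → x ∈ P → y ∈ P → x ∙ y ∈ P
      ⁻¹-closed : ∀ {x} → x ∈ P → x ⁻¹ ∈ P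

  subgroup : {P : Pred Carrier p} → IsSubgroup P → Group (c ⊔ p) ℓ
  subgroup {P = P} isSubgroup = record
    { Carrier = ∃ P
    ; _≈_     = λ x y → proj₁ x ≈ proj₁ y
    ; _∙_     = λ (x , x∈) (y , y∈) → x ∙ y , ∙-closed x∈ y∈
    ; ε       = ε , ε-closed
    ; _⁻¹     = λ (x , x∈) → x ⁻¹ , ⁻¹-closed x∈
    ; isGroup = record
      { isMonoid = record
        { isSemigroup = record
          { isMagma = record
            { isEquivalence = record
              { refl = Group.refl G ; sym = sym ; trans = trans }
            ; ∙-cong = ∙-cong
            }
          ; assoc = λ x y z → assoc (proj₁ x) (proj₁ y) (proj₁ z)
          }
        ; identity = (λ x → identityˡ (proj₁ x)) , (λ x → identityʳ (proj₁ x))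
        }
      ; inverse = (λ x → inverseˡ (proj₁ x)) , (λ x → inverseʳ (proj₁ x))
      ; ⁻¹-cong = ⁻¹-cong
      }
    }
    where open IsSubgroup isSubgroup

  data ⟨_⟩ (g : Carrier) : Pred Carrier (c ⊔ ℓ) where
    generator : g ∈ ⟨ g ⟩
    unit      : ε ∈ ⟨ g ⟩
    product   : ∀ {x y} → x ∈ ⟨ g ⟩ → y ∈ ⟨ g ⟩ → x ∙ y ∈ ⟨ g ⟩
    invert    : ∀ {x} → x ∈ ⟨ g ⟩ → x ⁻¹ ∈ ⟨ g ⟩
    respect   : ∀ {x y} → x ≈ y → x ∈ ⟨ g ⟩ → y ∈ ⟨ g ⟩

  ⟨⟩-isSubgroup : (g : Carrier) → IsSubgroup ⟨ g ⟩
  ⟨⟩-isSubgroup g = record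
    { resp = respect ; ε-closed = unit ; ∙-closed = product ; ⁻¹-closed = invert }

  infixl 7 _·_

  _·_ : Pred Carrier p → Pred Carrier q → Pred Carrier (c ⊔ ℓ ⊔ p ⊔ q)
  (P · Q) z = ∃[ x ] ∃[ y ] x ∈ P × y ∈ Q × z ≈ x ∙ y

  -- K = N ⋊ H, for subsets K, N, H of the ambient group G.
  record IsInternalSemidirectProduct
    (K : Pred Carrier p) (N : Pred Carrier q) (H : Pred Carrier r)
    : Set (c ⊔ ℓ ⊔ p ⊔ q ⊔ r) where
    field
      K-isSubgroup : IsSubgroup K
      N-isSubgroup : IsSubgroup N
      H-isSubgroup : IsSubgroup H
      normal       : ∀ {k x} → k ∈ K → x ∈ N → k ∙ x ∙ k ⁻¹ ∈ N
      trivial      : ∀ {x} → x ∈ N ∩ H → x ≈ ε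
      K≐N·H        : K ≐ N · H

-- A homomorphism H → Aut N: each h ▷_ is invertible by ε-▷ and ∙-▷.
record Action (H : Group c₁ ℓ₁) (N : Group c₂ ℓ₂) : Set (c₁ ⊔ ℓ₁ ⊔ c₂ ⊔ ℓ₂) where
  private
    module H = Group H
    module N = Group N
  infixr 8 _▷_
  field
    _▷_    : H.Carrier → N.Carrier → N.Carrier
    ▷-cong : ∀ {g h x y} → g H.≈ h → x N.≈ y → g ▷ x N.≈ h ▷ y
    ▷-∙    : ∀ h x y → h ▷ (x N.∙ y) N.≈ h ▷ x N.∙ h ▷ y
    ε-▷    : ∀ x → H.ε ▷ x N.≈ x
    ∙-▷    : ∀ g h x → (g H.∙ h) ▷ x N.≈ g ▷ h ▷ x

module _ (N : Group c₁ ℓ₁) (H : Group c₂ ℓ₂) (φ : Action H N) where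
  private
    module N = Group N
    module H = Group H
    open Action φ
    open SetoidReasoning N.setoid

    ▷-ε : ∀ h → h ▷ N.ε N.≈ N.ε
    ▷-ε h = GroupProperties.identityʳ-unique N (h ▷ N.ε) (h ▷ N.ε)
      (N.trans (N.sym (▷-∙ h N.ε N.ε)) (▷-cong H.refl (N.identityˡ N.ε)))

  semidirect : Group (c₁ ⊔ c₂) (ℓ₁ ⊔ ℓ₂)
  semidirect = record
    { Carrier = N.Carrier × H.Carrier
    ; _≈_     = λ (x , g) (y , h) → x N.≈ y × g H.≈ h
    ; _∙_     = λ (x , g) (y , h) → x N.∙ g ▷ y , g H.∙ h
    ; ε       = N.ε , H.ε
    ; _⁻¹     = λ (x , g) → (g H.⁻¹) ▷ (x N.⁻¹) , g H.⁻¹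
    ; isGroup = record
      { isMonoid = record
        { isSemigroup = record
          { isMagma = record
            { isEquivalence = record
              { refl  = N.refl , H.refl
              ; sym   = λ (p , q) → N.sym p , H.sym q
              ; trans = λ (p , q) (p′ , q′) → N.trans p p′ , H.trans q q′
              }
            ; ∙-cong = λ (p , q) (p′ , q′) → N.∙-cong p (▷-cong q p′) , H.∙-cong q q′
            }
          ; assoc = λ (x , g) (y , h) (z , k) →
              (begin
                (x N.∙ g ▷ y) N.∙ (g H.∙ h) ▷ z  ≈⟨ N.∙-congˡ (∙-▷ g h z) ⟩
                (x N.∙ g ▷ y) N.∙ g ▷ h ▷ z      ≈⟨ N.assoc _ _ _ ⟩
                x N.∙ (g ▷ y N.∙ g ▷ h ▷ z)      ≈⟨ N.∙-congˡ (▷-∙ g y (h ▷ z)) ⟨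
                x N.∙ g ▷ (y N.∙ h ▷ z)          ∎)
              , H.assoc g h k
          }
        ; identity =
            (λ (x , g) → N.trans (N.identityˡ _) (ε-▷ x) , H.identityˡ g)
          , (λ (x , g) → N.trans (N.∙-congˡ (▷-ε g)) (N.identityʳ x) , H.identityʳ g)
        }
      ; inverse =
          (λ (x , g) →
            (begin
              (g H.⁻¹) ▷ (x N.⁻¹) N.∙ (g H.⁻¹) ▷ x  ≈⟨ ▷-∙ _ _ _ ⟨
              (g H.⁻¹) ▷ (x N.⁻¹ N.∙ x)             ≈⟨ ▷-cong H.refl (N.inverseˡ x) ⟩
              (g H.⁻¹) ▷ N.ε                        ≈⟨ ▷-ε _ ⟩
              N.ε                                   ∎)
            , H.inverseˡ g)
        , (λ (x , g) →
            (begin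
              x N.∙ g ▷ (g H.⁻¹) ▷ (x N.⁻¹)   ≈⟨ N.∙-congˡ (∙-▷ _ _ _) ⟨
              x N.∙ (g H.∙ g H.⁻¹) ▷ (x N.⁻¹) ≈⟨ N.∙-congˡ (▷-cong (H.inverseʳ g) N.refl) ⟩
              x N.∙ H.ε ▷ (x N.⁻¹)            ≈⟨ N.∙-congˡ (ε-▷ _) ⟩
              x N.∙ x N.⁻¹                    ≈⟨ N.inverseʳ x ⟩
              N.ε                             ∎)
            , H.inverseʳ g)
      ; ⁻¹-cong = λ (p , q) → ▷-cong (H.⁻¹-cong q) (N.⁻¹-cong p) , H.⁻¹-cong q
      }
    }

ℤ₂ : Group 0ℓ 0ℓ
ℤ₂ = Parity.+-0-group

module _ (G : Group c ℓ) {P : Pred (Group.Carrier G) p} (P-isSubgroup : IsSubgroup G P)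
         (P-normal : ∀ g {x} → x ∈ P → Group._∙_ G (Group._∙_ G g x) (Group._⁻¹ G g) ∈ P)
         where
  open Group G
  open GroupProperties G
  open SetoidReasoning setoid

  private
    conj-∙ : ∀ g x y → g ∙ (x ∙ y) ∙ g ⁻¹ ≈ (g ∙ x ∙ g ⁻¹) ∙ (g ∙ y ∙ g ⁻¹)
    conj-∙ g x y = begin
      g ∙ (x ∙ y) ∙ g ⁻¹                   ≈⟨ ∙-congʳ (assoc g x y) ⟨
      g ∙ x ∙ y ∙ g ⁻¹                     ≈⟨ assoc _ _ _ ⟩
      g ∙ x ∙ (y ∙ g ⁻¹)                   ≈⟨ ∙-congˡ (\\-leftDividesʳ g _) ⟨
      g ∙ x ∙ (g ⁻¹ ∙ (g ∙ (y ∙ g ⁻¹)))    ≈⟨ assoc _ _ _ ⟨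
      g ∙ x ∙ g ⁻¹ ∙ (g ∙ (y ∙ g ⁻¹))      ≈⟨ ∙-congˡ (assoc g y (g ⁻¹)) ⟨
      (g ∙ x ∙ g ⁻¹) ∙ (g ∙ y ∙ g ⁻¹)      ∎

    conj-⁻¹ : ∀ g x → (g ∙ x ∙ g ⁻¹) ⁻¹ ≈ g ∙ x ⁻¹ ∙ g ⁻¹
    conj-⁻¹ g x = begin
      (g ∙ x ∙ g ⁻¹) ⁻¹       ≈⟨ ⁻¹-anti-homo-∙ _ _ ⟩
      g ⁻¹ ⁻¹ ∙ (g ∙ x) ⁻¹    ≈⟨ ∙-cong (⁻¹-involutive g) (⁻¹-anti-homo-∙ g x) ⟩
      g ∙ (x ⁻¹ ∙ g ⁻¹)       ≈⟨ assoc _ _ _ ⟨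
      g ∙ x ⁻¹ ∙ g ⁻¹         ∎

  conjugation : Action G (subgroup G P-isSubgroup)
  conjugation = record
    { _▷_    = λ g (x , x∈) → g ∙ x ∙ g ⁻¹ , P-normal g x∈
    ; ▷-cong = λ g≈h x≈y → ∙-cong (∙-cong g≈h x≈y) (⁻¹-cong g≈h)
    ; ▷-∙    = λ g (x , _) (y , _) → conj-∙ g x y
    ; ε-▷    = λ (x , _) → begin
        ε ∙ x ∙ ε ⁻¹  ≈⟨ ∙-cong (identityˡ x) ε⁻¹≈ε ⟩
        x ∙ ε         ≈⟨ identityʳ x ⟩
        x             ∎
    ; ∙-▷    = λ g h (x , _) → begin
        g ∙ h ∙ x ∙ (g ∙ h) ⁻¹        ≈⟨ ∙-cong (assoc g h x) (⁻¹-anti-homo-∙ g h) ⟩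
        g ∙ (h ∙ x) ∙ (h ⁻¹ ∙ g ⁻¹)   ≈⟨ assoc _ _ _ ⟨
        g ∙ (h ∙ x) ∙ h ⁻¹ ∙ g ⁻¹     ≈⟨ ∙-congʳ (assoc _ _ _) ⟩
        g ∙ (h ∙ x ∙ h ⁻¹) ∙ g ⁻¹     ∎
    }

  P⋊G : Group (c ⊔ p ⊔ c) (ℓ ⊔ ℓ)
  P⋊G = semidirect (subgroup G P-isSubgroup) G conjugation

  private
    module P⋊G = Group P⋊G

    twist : P⋊G.Carrier → P⋊G.Carrier
    twist ((x , x∈) , g) = (x ⁻¹ , IsSubgroup.⁻¹-closed P-isSubgroup x∈) , x ∙ g

    twist-cong : ∀ {u v} → u P⋊G.≈ v → twist u P⋊G.≈ twist v
    twist-cong (x≈y , g≈h) = ⁻¹-cong x≈y , ∙-cong x≈y g≈h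

    twist-∙ : ∀ u v → twist (u P⋊G.∙ v) P⋊G.≈ twist u P⋊G.∙ twist v
    twist-∙ ((x , _) , g) ((y , _) , h) =
      (begin
        (x ∙ (g ∙ y ∙ g ⁻¹)) ⁻¹                      ≈⟨ ⁻¹-anti-homo-∙ _ _ ⟩
        (g ∙ y ∙ g ⁻¹) ⁻¹ ∙ x ⁻¹                     ≈⟨ ∙-congʳ (conj-⁻¹ g y) ⟩
        g ∙ y ⁻¹ ∙ g ⁻¹ ∙ x ⁻¹                       ≈⟨ assoc _ _ _ ⟩
        g ∙ y ⁻¹ ∙ (g ⁻¹ ∙ x ⁻¹)                     ≈⟨ ∙-congˡ (⁻¹-anti-homo-∙ x g) ⟨
        g ∙ y ⁻¹ ∙ (x ∙ g) ⁻¹                        ≈⟨ \\-leftDividesʳ x _ ⟨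
        x ⁻¹ ∙ (x ∙ (g ∙ y ⁻¹ ∙ (x ∙ g) ⁻¹))         ≈⟨ ∙-congˡ (assoc _ _ _) ⟨
        x ⁻¹ ∙ (x ∙ (g ∙ y ⁻¹) ∙ (x ∙ g) ⁻¹)         ≈⟨ ∙-congˡ (∙-congʳ (assoc _ _ _)) ⟨
        x ⁻¹ ∙ (x ∙ g ∙ y ⁻¹ ∙ (x ∙ g) ⁻¹)           ∎)
      , (begin
        x ∙ (g ∙ y ∙ g ⁻¹) ∙ (g ∙ h)      ≈⟨ assoc _ _ _ ⟩
        x ∙ (g ∙ y ∙ g ⁻¹ ∙ (g ∙ h))      ≈⟨ ∙-congˡ (assoc _ _ _) ⟩
        x ∙ (g ∙ y ∙ (g ⁻¹ ∙ (g ∙ h)))    ≈⟨ ∙-congˡ (∙-congˡ (\\-leftDividesʳ g h)) ⟩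
        x ∙ (g ∙ y ∙ h)                   ≈⟨ ∙-congˡ (assoc g y h) ⟩
        x ∙ (g ∙ (y ∙ h))                 ≈⟨ assoc _ _ _ ⟨
        x ∙ g ∙ (y ∙ h)                   ∎)

    twist-involutive : ∀ u → twist (twist u) P⋊G.≈ u
    twist-involutive ((x , _) , g) = ⁻¹-involutive x , \\-leftDividesʳ x g

  -- Read (x , g) as the bijection a ↦ g⁻¹ (a x) g of P, i.e. right
  -- multiplication by x followed by conjugation by g.  Conjugating it by
  -- h : a ↦ a⁻¹ gives a ↦ g⁻¹ (x⁻¹ a) g = (x g)⁻¹ (a x⁻¹) (x g), that is
  -- (x⁻¹ , x g); this is how the nontrivial element of ℤ₂ acts.
  inversionAction : Action ℤ₂ P⋊G
  inversionAction = record
    { _▷_    = λ { 0ℙ u → u ; 1ℙ u → twist u }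
    ; ▷-cong = λ { {0ℙ}         ≡.refl u≈v → u≈v
                 ; {1ℙ} {_} {u} {v} ≡.refl u≈v → twist-cong {u} {v} u≈v }
    ; ▷-∙    = λ { 0ℙ u v → P⋊G.refl {u P⋊G.∙ v} ; 1ℙ u v → twist-∙ u v }
    ; ε-▷    = λ u → P⋊G.refl {u}
    ; ∙-▷    = λ { 0ℙ 0ℙ u → P⋊G.refl {u}
                 ; 0ℙ 1ℙ u → P⋊G.refl {twist u}
                 ; 1ℙ 0ℙ u → P⋊G.refl {twist u}
                 ; 1ℙ 1ℙ u → P⋊G.sym {twist (twist u)} {u} (twist-involutive u) }
    }

-- Products are read from left to right, f ∙ g being f followed by g, as
-- in Data.Fin.Permutation.
Sym : Setoid c ℓ → Group (c ⊔ ℓ) (c ⊔ ℓ)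
Sym A = record
  { Carrier = Inverse A A
  ; _≈_     = λ f g → ∀ x → to f x ≈ to g x
  ; _∙_     = Compose.inverse
  ; ε       = Identity.inverse A
  ; _⁻¹     = Symmetry.inverse
  ; isGroup = record
    { isMonoid = record
      { isSemigroup = record
        { isMagma = record
          { isEquivalence = record
            { refl  = λ _ → A.refl
            ; sym   = λ p x → A.sym (p x)
            ; trans = λ p q x → A.trans (p x) (q x)
            }
          ; ∙-cong = λ {_} {_} {g} p q x → A.trans (to-cong g (p x)) (q _)
          }
        ; assoc = λ _ _ _ _ → A.refl
        }
      ; identity = (λ _ _ → A.refl) , (λ _ _ → A.refl)
      }
    ; inverse = strictlyInverseˡ , strictlyInverseʳ
    ; ⁻¹-cong = λ {f} {g} p x → inverseʳ f (A.sym (A.trans (p _) (strictlyInverseˡ g x)))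
    }
  }
  where
  module A = Setoid A
  open A using (_≈_)
  open Inverse

module _ (G : Group c ℓ) where
  open Group G
  open GroupProperties G

  rightMultiplication : Carrier → Inverse setoid setoid
  rightMultiplication g = record
    { to        = _∙ g
    ; from      = _∙ g ⁻¹
    ; to-cong   = ∙-congʳ
    ; from-cong = ∙-congʳ
    ; inverse   = (λ {x} p → trans (∙-congʳ p) (//-rightDividesˡ g x))
                , (λ {x} p → trans (∙-congʳ p) (//-rightDividesʳ g x))
    }

  conjugationBy : Carrier → Inverse setoid setoid
  conjugationBy g = record
    { to        = λ x → g ⁻¹ ∙ x ∙ g
    ; from      = λ x → g ∙ x ∙ g ⁻¹
    ; to-cong   = λ p → ∙-congʳ (∙-congˡ p)
    ; from-cong = λ p → ∙-congʳ (∙-congˡ p)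
    ; inverse   = (λ {x} p → trans (∙-congʳ (∙-congˡ p)) (to-from x))
                , (λ {x} p → trans (∙-congʳ (∙-congˡ p)) (from-to x))
    }
    where
    open SetoidReasoning setoid
    to-from : ∀ x → g ⁻¹ ∙ (g ∙ x ∙ g ⁻¹) ∙ g ≈ x
    to-from x = begin
      g ⁻¹ ∙ (g ∙ x ∙ g ⁻¹) ∙ g    ≈⟨ ∙-congʳ (∙-congˡ (assoc _ _ _)) ⟩
      g ⁻¹ ∙ (g ∙ (x ∙ g ⁻¹)) ∙ g  ≈⟨ ∙-congʳ (\\-leftDividesʳ g _) ⟩
      x ∙ g ⁻¹ ∙ g                 ≈⟨ //-rightDividesˡ g x ⟩
      x                            ∎
    from-to : ∀ x → g ∙ (g ⁻¹ ∙ x ∙ g) ∙ g ⁻¹ ≈ x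
    from-to x = begin
      g ∙ (g ⁻¹ ∙ x ∙ g) ∙ g ⁻¹    ≈⟨ ∙-congʳ (∙-congˡ (assoc _ _ _)) ⟩
      g ∙ (g ⁻¹ ∙ (x ∙ g)) ∙ g ⁻¹  ≈⟨ ∙-congʳ (\\-leftDividesˡ g _) ⟩
      x ∙ g ∙ g ⁻¹                 ≈⟨ //-rightDividesʳ g x ⟩
      x                            ∎

  inversion : Inverse setoid setoid
  inversion = record
    { to        = _⁻¹
    ; from      = _⁻¹
    ; to-cong   = ⁻¹-cong
    ; from-cong = ⁻¹-cong
    ; inverse   = (λ {x} p → trans (⁻¹-cong p) (⁻¹-involutive x))
                , (λ {x} p → trans (⁻¹-cong p) (⁻¹-involutive x))
    }

  private module SymG = Group (Sym setoid)

  RightRegular : Pred SymG.Carrier (c ⊔ ℓ)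
  RightRegular f = ∃[ g ] f SymG.≈ rightMultiplication g

  Inn : Pred SymG.Carrier (c ⊔ ℓ)
  Inn f = ∃[ g ] f SymG.≈ conjugationBy g

record Graph (c ℓ e : Level) : Set (suc (c ⊔ ℓ ⊔ e)) where
  field
    vertices : Setoid c ℓ
  open Setoid vertices public using (_≈_) renaming (Carrier to Vertex)
  field
    Adjacent : Rel Vertex e
    resp     : Adjacent Respects₂ _≈_
    symmetric   : Symmetric Adjacent
    irreflexive : Irreflexive _≈_ Adjacent

module _ {e} (Γ : Graph c ℓ e) where
  open Graph Γ
  open Inverse

  IsAutomorphism : Pred (Inverse vertices vertices) (c ⊔ e)
  IsAutomorphism f = ∀ x y → Adjacent x y ⇔ Adjacent (to f x) (to f y)

  private
    module V = Setoid vertices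

    shift : ∀ {x x′ y y′} → x ≈ x′ → y ≈ y′ → Adjacent x y → Adjacent x′ y′
    shift p q = proj₂ resp p ∘ proj₁ resp q

  IsAutomorphism-isSubgroup : IsSubgroup (Sym vertices) IsAutomorphism
  IsAutomorphism-isSubgroup = record
    { resp      = λ f≈g f∈ x y → mk⇔
        (shift (f≈g x) (f≈g y) ∘ Equivalence.to (f∈ x y))
        (Equivalence.from (f∈ x y) ∘ shift (V.sym (f≈g x)) (V.sym (f≈g y)))
    ; ε-closed  = λ x y → mk⇔ (λ a → a) (λ a → a)
    ; ∙-closed  = λ {f} {g} f∈ g∈ x y → mk⇔
        (Equivalence.to (g∈ (to f x) (to f y)) ∘ Equivalence.to (f∈ x y))
        (Equivalence.from (f∈ x y) ∘ Equivalence.from (g∈ (to f x) (to f y)))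
    ; ⁻¹-closed = λ {f} f∈ x y → mk⇔
        (Equivalence.from (f∈ (from f x) (from f y))
          ∘ shift (V.sym (strictlyInverseˡ f x)) (V.sym (strictlyInverseˡ f y)))
        (shift (strictlyInverseˡ f x) (strictlyInverseˡ f y)
          ∘ Equivalence.to (f∈ (from f x) (from f y)))
    }

  Aut : Group (c ⊔ ℓ ⊔ e) (c ⊔ ℓ)
  Aut = subgroup (Sym vertices) IsAutomorphism-isSubgroup

module _ (Γ : Group c ℓ) where
  open Group Γ
  open GroupProperties Γ

  record IsConnectionSet (T : Pred Carrier p) : Set (c ⊔ ℓ ⊔ p) where
    field
      resp      : T Respects _≈_
      ε∉        : ε ∉ T
      ⁻¹-closed : ∀ {t} → t ∈ T → t ⁻¹ ∈ T

  Cay : {T : Pred Carrier p} → IsConnectionSet T → Graph c ℓ (c ⊔ ℓ ⊔ p)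
  Cay {T = T} isConnectionSet = record
    { vertices = setoid
    ; Adjacent = λ γ δ → ∃[ t ] t ∈ T × δ ≈ t ∙ γ
    ; resp     = (λ δ≈δ′ (t , t∈ , p) → t , t∈ , trans (sym δ≈δ′) p)
               , (λ γ≈γ′ (t , t∈ , p) → t , t∈ , trans p (∙-congˡ γ≈γ′))
    ; symmetric   = λ {γ} (t , t∈ , p) → t ⁻¹ , ⁻¹-closed t∈ ,
        trans (sym (\\-leftDividesʳ t γ)) (∙-congˡ (sym p))
    ; irreflexive = λ {γ} γ≈δ (t , t∈ , p) →
        ε∉ (resp (identityˡ-unique t γ (sym (trans γ≈δ p))) t∈)
    }
    where open IsConnectionSet isConnectionSet

S : ℕ → Group 0ℓ 0ℓ
S n = Sym (≡.setoid (Fin n))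

-- The condition i ≢ j is needed because transpose i i is the identity.
Even : ∀ {n} → Pred (Permutation′ n) 0ℓ
Even {n} σ = Σ[ ts ∈ TranspositionList n ]
  All (λ (i , j) → i ≢ j) ts × 2 ∣ length ts × eval ts Perm.≈ σ

private
  transpose-fst : ∀ {n} (a b : Fin n) → PC.transpose a b a ≡ b
  transpose-fst a b with a ≟ a
  ... | yes _ = refl
  ... | no ¬p = contradiction refl ¬p

  transpose-snd : ∀ {n} (a b : Fin n) → PC.transpose a b b ≡ a
  transpose-snd a b with b ≟ a
  ... | yes p = p
  ... | no _ with b ≟ b
  ...   | yes _ = refl
  ...   | no ¬p = contradiction refl ¬p

  transpose-other : ∀ {n} {a b l : Fin n} → l ≢ a → l ≢ b → PC.transpose a b l ≡ l
  transpose-other {_} {a} {b} {l} l≢a l≢b with l ≟ a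
  ... | yes p = contradiction p l≢a
  ... | no  _ with l ≟ b
  ...   | yes p = contradiction p l≢b
  ...   | no  _ = refl

module _ {n : ℕ} where
  private
    module S = Group (S n)

    eval-++ : ∀ (ts us : TranspositionList n) → eval (ts ++ us) Perm.≈ eval ts ∘ₚ eval us
    eval-++ []       us k = refl
    eval-++ (t ∷ ts) us k = eval-++ ts us _

    transpose-sym : ∀ (i j k : Fin n) → PC.transpose i j k ≡ PC.transpose j i k
    transpose-sym i j k = go (k ≟ i) (k ≟ j)
      where
      go : Dec (k ≡ i) → Dec (k ≡ j) → PC.transpose i j k ≡ PC.transpose j i k
      go (yes refl) _          = ≡.trans (transpose-fst k j) (≡.sym (transpose-snd j k))
      go (no k≢i)   (yes refl) = ≡.trans (transpose-snd i k) (≡.sym (transpose-fst k i))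
      go (no k≢i)   (no k≢j)   =
        ≡.trans (transpose-other k≢i k≢j) (≡.sym (transpose-other k≢j k≢i))

    eval-reverse : ∀ (ts : TranspositionList n) → eval (reverse ts) Perm.≈ Perm.flip (eval ts)
    eval-reverse []             k = refl
    eval-reverse ((i , j) ∷ ts) k = begin
      eval (reverse ((i , j) ∷ ts)) ⟨$⟩ʳ k
        ≡⟨ cong (λ us → eval us ⟨$⟩ʳ k) (unfold-reverse (i , j) ts) ⟩
      eval (reverse ts ++ [ i , j ]) ⟨$⟩ʳ k
        ≡⟨ eval-++ (reverse ts) [ i , j ] k ⟩
      PC.transpose i j (eval (reverse ts) ⟨$⟩ʳ k)
        ≡⟨ cong (PC.transpose i j) (eval-reverse ts k) ⟩
      PC.transpose i j (eval ts ⟨$⟩ˡ k)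
        ≡⟨ transpose-sym i j (eval ts ⟨$⟩ˡ k) ⟩
      PC.transpose j i (eval ts ⟨$⟩ˡ k) ∎
      where open ≡.≡-Reasoning

    All-reverse : ∀ {P : Pred (Fin n × Fin n) 0ℓ} ts → All P ts → All P (reverse ts)
    All-reverse     []       []         = []
    All-reverse {P} (t ∷ ts) (pt ∷ pts) =
      ≡.subst (All P) (≡.sym (unfold-reverse t ts)) (All.∷ʳ⁺ (All-reverse ts pts) pt)

  Even-isSubgroup : IsSubgroup (S n) Even
  Even-isSubgroup = record
    { resp      = λ σ≈τ (ts , ts≢ , even , p) → ts , ts≢ , even , λ k → ≡.trans (p k) (σ≈τ k)
    ; ε-closed  = [] , [] , 2 ∣0 , λ _ → refl
    ; ∙-closed  = λ {σ} {τ} (ts , ts≢ , even , p) (us , us≢ , even′ , q) →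
        ts ++ us , All.++⁺ ts≢ us≢ ,
        ≡.subst (2 ∣_) (≡.sym (length-++ ts)) (∣m∣n⇒∣m+n even even′) ,
        λ k → ≡.trans (eval-++ ts us k) (≡.trans (q _) (cong (τ ⟨$⟩ʳ_) (p k)))
    ; ⁻¹-closed = λ {σ} (ts , ts≢ , even , p) →
        reverse ts , All-reverse ts ts≢ ,
        ≡.subst (2 ∣_) (≡.sym (length-reverse ts)) even ,
        λ k → ≡.trans (eval-reverse ts k) (S.⁻¹-cong {eval ts} {σ} p k)
    }

  private
    σ-injective : ∀ (σ : Permutation′ n) {i j} → σ ⟨$⟩ʳ i ≡ σ ⟨$⟩ʳ j → i ≡ j
    σ-injective σ p = ≡.trans (≡.sym (Perm.inverseˡ σ)) (≡.trans (cong (σ ⟨$⟩ˡ_) p) (Perm.inverseˡ σ))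

    transpose-conj : ∀ (σ : Permutation′ n) i j k →
      PC.transpose (σ ⟨$⟩ʳ i) (σ ⟨$⟩ʳ j) (σ ⟨$⟩ʳ k) ≡ σ ⟨$⟩ʳ PC.transpose i j k
    transpose-conj σ i j k = go (k ≟ i) (k ≟ j)
      where
      go : Dec (k ≡ i) → Dec (k ≡ j) →
           PC.transpose (σ ⟨$⟩ʳ i) (σ ⟨$⟩ʳ j) (σ ⟨$⟩ʳ k) ≡ σ ⟨$⟩ʳ PC.transpose i j k
      go (yes refl) _          =
        ≡.trans (transpose-fst (σ ⟨$⟩ʳ i) (σ ⟨$⟩ʳ j)) (cong (σ ⟨$⟩ʳ_) (≡.sym (transpose-fst k j)))
      go (no k≢i)   (yes refl) =
        ≡.trans (transpose-snd (σ ⟨$⟩ʳ i) (σ ⟨$⟩ʳ j)) (cong (σ ⟨$⟩ʳ_) (≡.sym (transpose-snd i k)))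
      go (no k≢i)   (no k≢j)   = ≡.trans
        (transpose-other (k≢i ∘ σ-injective σ) (k≢j ∘ σ-injective σ))
        (cong (σ ⟨$⟩ʳ_) (≡.sym (transpose-other k≢i k≢j)))

    eval-conj : ∀ (σ : Permutation′ n) (ts : TranspositionList n) k →
      eval (map (λ (i , j) → σ ⟨$⟩ʳ i , σ ⟨$⟩ʳ j) ts) ⟨$⟩ʳ (σ ⟨$⟩ʳ k) ≡ σ ⟨$⟩ʳ (eval ts ⟨$⟩ʳ k)
    eval-conj σ []             k = refl
    eval-conj σ ((i , j) ∷ ts) k = ≡.trans
      (cong (eval (map _ ts) ⟨$⟩ʳ_) (transpose-conj σ i j k))
      (eval-conj σ ts (PC.transpose i j k))

  Even-normal : ∀ σ {π} → π ∈ Even → σ S.∙ π S.∙ σ S.⁻¹ ∈ Even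
  Even-normal σ {π} (ts , ts≢ , even , p) =
    map (λ (i , j) → σ⁻¹ ⟨$⟩ʳ i , σ⁻¹ ⟨$⟩ʳ j) ts ,
    All.map⁺ (All.map (λ i≢j → i≢j ∘ σ-injective σ⁻¹) ts≢) ,
    ≡.subst (2 ∣_) (≡.sym (length-map _ ts)) even ,
    λ k → ≡.trans (cong (eval (map _ ts) ⟨$⟩ʳ_) (≡.sym (Perm.inverseˡ σ)))
          (≡.trans (eval-conj σ⁻¹ ts (σ ⟨$⟩ʳ k)) (cong (σ⁻¹ ⟨$⟩ʳ_) (p _)))
    where σ⁻¹ = Perm.flip σ

A : ℕ → Group 0ℓ 0ℓ
A n = subgroup (S n) Even-isSubgroup

record IsThreeCycle {n : ℕ} (σ : Permutation′ n) : Set where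
  constructor threeCycle
  field
    {i j k} : Fin n
    i≢j     : i ≢ j
    j≢k     : j ≢ k
    k≢i     : k ≢ i
    i↦j     : σ ⟨$⟩ʳ i ≡ j
    j↦k     : σ ⟨$⟩ʳ j ≡ k
    k↦i     : σ ⟨$⟩ʳ k ≡ i
    fixes   : ∀ l → l ≢ i → l ≢ j → l ≢ k → σ ⟨$⟩ʳ l ≡ l

IsThreeCycle⊆Even : ∀ {n} → IsThreeCycle {n} ⊆ Even
IsThreeCycle⊆Even {n} {σ} (threeCycle {i} {j} {k} i≢j j≢k k≢i i↦j j↦k k↦i fixes) =
  (i , j) ∷ (i , k) ∷ [] , i≢j ∷ (k≢i ∘ ≡.sym) ∷ [] , divides 1 refl , agree
  where
  step : ∀ {l m o} → PC.transpose i j l ≡ m → PC.transpose i k m ≡ o → σ ⟨$⟩ʳ l ≡ o →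
         PC.transpose i k (PC.transpose i j l) ≡ σ ⟨$⟩ʳ l
  step p q r = ≡.trans (cong (PC.transpose i k) p) (≡.trans q (≡.sym r))

  agree : ∀ l → PC.transpose i k (PC.transpose i j l) ≡ σ ⟨$⟩ʳ l
  agree l = go (l ≟ i) (l ≟ j) (l ≟ k)
    where
    go : Dec (l ≡ i) → Dec (l ≡ j) → Dec (l ≡ k) →
         PC.transpose i k (PC.transpose i j l) ≡ σ ⟨$⟩ʳ l
    go (yes refl) _ _ = step (transpose-fst i j) (transpose-other (i≢j ∘ ≡.sym) j≢k) i↦j
    go (no _) (yes refl) _ = step (transpose-snd i j) (transpose-fst i k) j↦k
    go (no _) (no _) (yes refl) =
      step (transpose-other k≢i (j≢k ∘ ≡.sym)) (transpose-snd i k) k↦i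
    go (no l≢i) (no l≢j) (no l≢k) =
      step (transpose-other l≢i l≢j) (transpose-other l≢i l≢k) (fixes l l≢i l≢j l≢k)

-- By IsThreeCycle⊆Even no 3-cycle of S n is lost here.
ThreeCycles : ∀ n → Pred (Group.Carrier (A n)) 0ℓ
ThreeCycles n = IsThreeCycle ∘ proj₁

ThreeCycles-isConnectionSet : ∀ n → IsConnectionSet (A n) (ThreeCycles n)
ThreeCycles-isConnectionSet n = record
  { resp      = λ σ≈τ (threeCycle i≢j j≢k k≢i i↦j j↦k k↦i fixes) →
      threeCycle i≢j j≢k k≢i (≡.trans (≡.sym (σ≈τ _)) i↦j) (≡.trans (≡.sym (σ≈τ _)) j↦k)
        (≡.trans (≡.sym (σ≈τ _)) k↦i)
        (λ l p q r → ≡.trans (≡.sym (σ≈τ l)) (fixes l p q r))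
  ; ε∉        = λ c → IsThreeCycle.i≢j c (IsThreeCycle.i↦j c)
  ; ⁻¹-closed = λ { {σ , _} (threeCycle i≢j j≢k k≢i i↦j j↦k k↦i fixes) →
      threeCycle (k≢i ∘ ≡.sym) (j≢k ∘ ≡.sym) (i≢j ∘ ≡.sym)
        (back σ k↦i) (back σ j↦k) (back σ i↦j)
        (λ l p q r → back σ (fixes l p r q)) }
  }
  where
  back : ∀ (σ : Permutation′ n) {a b} → σ ⟨$⟩ʳ a ≡ b → σ ⟨$⟩ˡ b ≡ a
  back σ refl = Perm.inverseˡ σ

CAG : ℕ → Graph 0ℓ 0ℓ 0ℓ
CAG n = Cay (A n) (ThreeCycles-isConnectionSet n)

SymA : ℕ → Group 0ℓ 0ℓ
SymA n = Sym (Group.setoid (A n))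

-- The bijections of A n obtained by restricting inner automorphisms of S n.
InnS : ∀ n → Pred (Group.Carrier (SymA n)) 0ℓ
InnS n f = ∃[ φ ] φ ∈ Inn (S n) × (∀ α → proj₁ (Inverse.to f α) S.≈ Inverse.to φ (proj₁ α))
  where module S = Group (S n)

A⋊S : ℕ → Group 0ℓ 0ℓ
A⋊S n = semidirect (A n) (S n) (conjugation (S n) Even-isSubgroup Even-normal)

[A⋊S]⋊ℤ₂ : ℕ → Group 0ℓ 0ℓ
[A⋊S]⋊ℤ₂ n = semidirect (A⋊S n) ℤ₂ (inversionAction (S n) Even-isSubgroup Even-normal)

{-# OPTIONS --safe #-}

-- Two 3-cycles are adjacent iff they are mutually inverse or agree on an arc
-- p ↦ q with p ≢ q.  An inverse pair has no common neighbour among the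
-- 3-cycles, whereas for n ≥ 5 two 3-cycles with a common arc have one; so an
-- automorphism f fixing ε maps the pencil of 3-cycles through an arc to such a
-- pencil, and thereby acts on arcs, commuting with reversal.  Any two arcs out
-- of a vertex have images with exactly one of tail and head in common; this
-- makes the images of all arcs out of a vertex share their tail, or all their
-- head, with the same alternative at every vertex.  Hence f acts on the
-- 3-cycles as conjugation by some π, possibly composed with inversion.
-- An automorphism f fixing ε and all 3-cycles is trivial: for a 3-cycle s the
-- automorphism α ↦ f (α s) s⁻¹ fixes ε and enough 3-cycles to force its π to
-- be the identity, so that f also fixes the neighbours of s, and so on along
-- words in the 3-cycles, which generate A n.
module Submission where

open import Algebra.Bundles using (Group)
open import Algebra.Morphism.Structures
  using (IsMagmaHomomorphism; IsMagmaMonomorphism; IsGroupMonomorphism)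
import Algebra.Properties.Group as GroupProperties
open import Data.Empty using (⊥; ⊥-elim)
open import Data.Fin.Base using (Fin; fromℕ<; punchOut)
open import Data.Fin.Patterns using (0F; 1F; 2F; 3F)
open import Data.Fin.Permutation as Perm
  using (Permutation′; transpose; _⟨$⟩ʳ_; _⟨$⟩ˡ_; _∘ₚ_)
import Data.Fin.Permutation.Components as PC
open import Data.Fin.Permutation.Transposition.List using (eval)
open import Data.Fin.Properties
  using (_≟_; any?; all?; ¬∀⟶∃¬; injective⇒≤; <⇒notInjective; punchOut-injective)
open import Data.List.Base using ([]; _∷_; length)
open import Data.List.Relation.Unary.All using (All; []; _∷_)
open import Data.Nat.Base using (ℕ; zero; suc; _≤_; _<_; z≤n; s≤s)
open import Data.Nat.Divisibility using (_∣_; ∣m+n∣m⇒∣n; ∣-refl; ∣⇒≤)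
open import Data.Nat.Properties using (<⇒≱; ≤-refl; ≤-trans)
open import Data.Parity.Base using (Parity; 0ℙ; 1ℙ)
open import Data.Product.Base using (_×_; _,_; proj₁; proj₂; ∃; ∃-syntax; ∃₂)
open import Data.Sum.Base as Sum using (_⊎_; inj₁; inj₂; swap)
open import Data.Vec.Base using (lookup; []; _∷_)
open import Function.Base using (_∘_)
open import Function.Bundles using (Inverse; Equivalence; mk⇔)
open import Function.Definitions using (Injective)
open import Level using (Level; _⊔_)
open import Relation.Binary.Definitions using (_Respects_)
open import Relation.Binary.PropositionalEquality
  using (_≡_; _≢_; refl; sym; trans; cong; subst; subst₂; ≢-sym)
import Relation.Binary.Reasoning.Setoid as SetoidReasoning
open import Relation.Nullary using (Dec; yes; no; ¬_; ¬?; contradiction)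
open import Relation.Nullary.Decidable using (decidable-stable)
open import Relation.Unary using (Pred; _∈_; _≐_)
open import Defs

private
  variable
    ℓ₁ ℓ₂ ℓ₃ c₁ c₂ c₃ k₁ k₂ k₃ : Level
    m n : ℕ
    a b c d p q r x y p′ q′ : Fin n
    σ τ υ : Permutation′ n

-- Semidirect products

MagmaHom : (G : Group c₁ ℓ₁) (H : Group c₂ ℓ₂) →
           (Group.Carrier G → Group.Carrier H) → Set (c₁ ⊔ ℓ₁ ⊔ ℓ₂)
MagmaHom G H = IsMagmaHomomorphism (Group.rawMagma G) (Group.rawMagma H)

MagmaMono : (G : Group c₁ ℓ₁) (H : Group c₂ ℓ₂) →
            (Group.Carrier G → Group.Carrier H) → Set (c₁ ⊔ ℓ₁ ⊔ ℓ₂)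
MagmaMono G H = IsMagmaMonomorphism (Group.rawMagma G) (Group.rawMagma H)

module _ (G : Group c₁ ℓ₁) (H : Group c₂ ℓ₂) where
  private
    module G = Group G
    module H = Group H

  Image : (G.Carrier → H.Carrier) → Pred H.Carrier (c₁ ⊔ ℓ₂)
  Image f z = ∃[ x ] z H.≈ f x

  module _ {f : G.Carrier → H.Carrier} (hom : MagmaHom G H f) where
    open IsMagmaHomomorphism hom
    open GroupProperties H
    open SetoidReasoning H.setoid

    ε-homo : f G.ε H.≈ H.ε
    ε-homo = identityʳ-unique (f G.ε) (f G.ε)
      (H.trans (H.sym (homo G.ε G.ε)) (⟦⟧-cong (G.identityˡ G.ε)))

    ⁻¹-homo : ∀ x → f (x G.⁻¹) H.≈ f x H.⁻¹
    ⁻¹-homo x = inverseˡ-unique (f (x G.⁻¹)) (f x) (begin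
      f (x G.⁻¹) H.∙ f x  ≈⟨ homo (x G.⁻¹) x ⟨
      f (x G.⁻¹ G.∙ x)    ≈⟨ ⟦⟧-cong (G.inverseˡ x) ⟩
      f G.ε               ≈⟨ ε-homo ⟩
      H.ε                 ∎)

    isSubgroup-Image : {K : Pred H.Carrier k₁} → K ≐ Image f → IsSubgroup H K
    isSubgroup-Image (⊆ , ⊇) = record
      { resp      = λ x≈y x∈ → let a , p = ⊆ x∈ in ⊇ (a , H.trans (H.sym x≈y) p)
      ; ε-closed  = ⊇ (G.ε , H.sym ε-homo)
      ; ∙-closed  = λ x∈ y∈ → let a , p = ⊆ x∈ ; b , q = ⊆ y∈ in
          ⊇ (a G.∙ b , H.trans (H.∙-cong p q) (H.sym (homo a b)))
      ; ⁻¹-closed = λ x∈ → let a , p = ⊆ x∈ in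
          ⊇ (a G.⁻¹ , H.trans (H.⁻¹-cong p) (H.sym (⁻¹-homo a)))
      }

  module _ {f : G.Carrier → H.Carrier} (mono : MagmaMono G H f) where
    open IsMagmaMonomorphism mono

    magma⇒groupMonomorphism : IsGroupMonomorphism G.rawGroup H.rawGroup f
    magma⇒groupMonomorphism = record
      { isGroupHomomorphism = record
        { isMonoidHomomorphism = record
          { isMagmaHomomorphism = isMagmaHomomorphism
          ; ε-homo              = ε-homo isMagmaHomomorphism
          }
        ; ⁻¹-homo = ⁻¹-homo isMagmaHomomorphism
        }
      ; injective = injective
      }

module _ (G : Group c₁ ℓ₁) (H : Group c₂ ℓ₂) where
  private
    module G = Group G
    module H = Group H

  subgroup≅ : ∀ {f} → MagmaMono G H f → {K : Pred H.Carrier k₁} (K-isSubgroup : IsSubgroup H K) →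
              K ≐ Image G H f → subgroup H K-isSubgroup ≅ G
  subgroup≅ {f = f} mono K-isSubgroup (⊆ , ⊇) = pre , record
    { isGroupMonomorphism = magma⇒groupMonomorphism (subgroup H K-isSubgroup) G record
      { isMagmaHomomorphism = record
        { isRelHomomorphism = record
          { cong = λ {x} {y} x≈y → injective
              (H.trans (H.sym (pre-spec x)) (H.trans x≈y (pre-spec y)))
          }
        ; homo = λ x y → injective (H.trans (H.sym (pre-spec _))
            (H.trans (H.∙-cong (pre-spec x) (pre-spec y)) (H.sym (homo (pre x) (pre y)))))
        }
      ; injective = λ {x} {y} p → H.trans (pre-spec x) (H.trans (⟦⟧-cong p) (H.sym (pre-spec y)))
      }
    ; surjective = λ a → (f a , ⊇ (a , H.refl)) , λ {z} z≈ →
        injective (H.trans (H.sym (pre-spec z)) z≈)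
    }
    where
    open IsMagmaMonomorphism mono
    pre : ∃ _ → G.Carrier
    pre (x , x∈) = proj₁ (⊆ x∈)

    pre-spec : ∀ z → proj₁ z H.≈ f (pre z)
    pre-spec (x , x∈) = proj₂ (⊆ x∈)

module SemidirectEmbedding
  (N : Group c₁ ℓ₁) (H : Group c₂ ℓ₂) (φ : Action H N) (G : Group c₃ ℓ₃)
  {f : Group.Carrier N → Group.Carrier G} (f-mono : MagmaMono N G f)
  {g : Group.Carrier H → Group.Carrier G} (g-mono : MagmaMono H G g)
  (compatible : ∀ h x →
    Group._≈_ G (Group._∙_ G (g h) (f x)) (Group._∙_ G (f (Action._▷_ φ h x)) (g h)))
  (disjoint : ∀ {x h} → Group._≈_ G (f x) (g h) → Group._≈_ N x (Group.ε N))
  where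

  private
    module N = Group N
    module H = Group H
    module G = Group G
    module f = IsMagmaMonomorphism f-mono
    module g = IsMagmaMonomorphism g-mono
    N⋊H = semidirect N H φ
    module N⋊H = Group N⋊H
  open Action φ
  open GroupProperties G
  open SetoidReasoning G.setoid

  ⟦_⟧ : N⋊H.Carrier → G.Carrier
  ⟦ x , h ⟧ = f x G.∙ g h

  ⟦⟧-homo : ∀ u v → ⟦ u N⋊H.∙ v ⟧ G.≈ ⟦ u ⟧ G.∙ ⟦ v ⟧
  ⟦⟧-homo (x , h) (y , k) = begin
    f (x N.∙ h ▷ y) G.∙ g (h H.∙ k)          ≈⟨ G.∙-cong (f.homo x (h ▷ y)) (g.homo h k) ⟩
    f x G.∙ f (h ▷ y) G.∙ (g h G.∙ g k)      ≈⟨ G.assoc _ _ _ ⟩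
    f x G.∙ (f (h ▷ y) G.∙ (g h G.∙ g k))    ≈⟨ G.∙-congˡ (G.assoc _ _ _) ⟨
    f x G.∙ (f (h ▷ y) G.∙ g h G.∙ g k)      ≈⟨ G.∙-congˡ (G.∙-congʳ (compatible h y)) ⟨
    f x G.∙ (g h G.∙ f y G.∙ g k)            ≈⟨ G.∙-congˡ (G.assoc _ _ _) ⟩
    f x G.∙ (g h G.∙ (f y G.∙ g k))          ≈⟨ G.assoc _ _ _ ⟨
    f x G.∙ g h G.∙ (f y G.∙ g k)            ∎

  ⟦⟧-homomorphism : MagmaHom N⋊H G ⟦_⟧
  ⟦⟧-homomorphism = record
    { isRelHomomorphism = record { cong = λ (p , q) → G.∙-cong (f.⟦⟧-cong p) (g.⟦⟧-cong q) }
    ; homo = ⟦⟧-homo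
    }

  ⟦⟧-trivialKernel : ∀ {x h} → ⟦ x , h ⟧ G.≈ G.ε → x N.≈ N.ε × h H.≈ H.ε
  ⟦⟧-trivialKernel {x} {h} p = x≈ε , h≈ε
    where
    x≈ε : x N.≈ N.ε
    x≈ε = disjoint (G.trans (inverseˡ-unique (f x) (g h) p)
      (G.sym (⁻¹-homo H G g.isMagmaHomomorphism h)))
    h≈ε : h H.≈ H.ε
    h≈ε = g.injective (begin
      g h          ≈⟨ G.identityˡ (g h) ⟨
      G.ε G.∙ g h  ≈⟨ G.∙-congʳ (ε-homo N G f.isMagmaHomomorphism) ⟨
      f N.ε G.∙ g h ≈⟨ G.∙-congʳ (f.⟦⟧-cong x≈ε) ⟨
      f x G.∙ g h  ≈⟨ p ⟩
      G.ε          ≈⟨ ε-homo H G g.isMagmaHomomorphism ⟨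
      g H.ε        ∎)

  ⟦⟧-injective : ∀ {u v} → ⟦ u ⟧ G.≈ ⟦ v ⟧ → u N⋊H.≈ v
  ⟦⟧-injective {u} {v} p = GroupProperties.x∙y⁻¹≈ε⇒x≈y N⋊H u v (⟦⟧-trivialKernel (begin
    ⟦ u N⋊H.∙ v N⋊H.⁻¹ ⟧      ≈⟨ ⟦⟧-homo u (v N⋊H.⁻¹) ⟩
    ⟦ u ⟧ G.∙ ⟦ v N⋊H.⁻¹ ⟧    ≈⟨ G.∙-congˡ (⁻¹-homo N⋊H G ⟦⟧-homomorphism v) ⟩
    ⟦ u ⟧ G.∙ ⟦ v ⟧ G.⁻¹      ≈⟨ x≈y⇒x∙y⁻¹≈ε p ⟩
    G.ε                       ∎))

  ⟦⟧-monomorphism : MagmaMono N⋊H G ⟦_⟧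
  ⟦⟧-monomorphism = record
    { isMagmaHomomorphism = ⟦⟧-homomorphism
    ; injective           = λ {u} {v} → ⟦⟧-injective {u} {v}
    }

  module _ {K : Pred G.Carrier k₁} {P : Pred G.Carrier k₂} {Q : Pred G.Carrier k₃}
           (K≐ : K ≐ Image N⋊H G ⟦_⟧) (P≐ : P ≐ Image N G f) (Q≐ : Q ≐ Image H G g) where

    isInternalSemidirectProduct : IsInternalSemidirectProduct G K P Q
    isInternalSemidirectProduct = record
      { K-isSubgroup = isSubgroup-Image N⋊H G ⟦⟧-homomorphism K≐
      ; N-isSubgroup = isSubgroup-Image N G f.isMagmaHomomorphism P≐
      ; H-isSubgroup = isSubgroup-Image H G g.isMagmaHomomorphism Q≐
      ; normal       = normal
      ; trivial      = λ (z∈P , z∈Q) → let (x , p) = proj₁ P≐ z∈P ; (h , q) = proj₁ Q≐ z∈Q in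
          G.trans p (G.trans (f.⟦⟧-cong (disjoint (G.trans (G.sym p) q)))
            (ε-homo N G f.isMagmaHomomorphism))
      ; K≐N·H        =
          (λ z∈K → let (x , h) , p = proj₁ K≐ z∈K in
            f x , g h , proj₂ P≐ (x , G.refl) , proj₂ Q≐ (h , G.refl) , p)
        , (λ (_ , _ , x∈ , h∈ , r) → let (x , p) = proj₁ P≐ x∈ ; (h , q) = proj₁ Q≐ h∈ in
            proj₂ K≐ ((x , h) , G.trans r (G.∙-cong p q)))
      }
      where
      normal : ∀ {k x} → k ∈ K → x ∈ P → k G.∙ x G.∙ k G.⁻¹ ∈ P
      normal {k} {z} k∈ z∈ with (x , h) , p ← proj₁ K≐ k∈ | y , q ← proj₁ P≐ z∈ =
        proj₂ P≐ (x N.∙ h ▷ y N.∙ x N.⁻¹ , (begin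
          k G.∙ z G.∙ k G.⁻¹
            ≈⟨ G.∙-cong (G.∙-cong p q) (G.⁻¹-cong p) ⟩
          f x G.∙ g h G.∙ f y G.∙ (f x G.∙ g h) G.⁻¹
            ≈⟨ G.∙-cong (G.assoc _ _ _) (⁻¹-anti-homo-∙ _ _) ⟩
          f x G.∙ (g h G.∙ f y) G.∙ (g h G.⁻¹ G.∙ f x G.⁻¹)
            ≈⟨ G.∙-congʳ (G.∙-congˡ (compatible h y)) ⟩
          f x G.∙ (f (h ▷ y) G.∙ g h) G.∙ (g h G.⁻¹ G.∙ f x G.⁻¹)
            ≈⟨ G.assoc _ _ _ ⟨
          f x G.∙ (f (h ▷ y) G.∙ g h) G.∙ g h G.⁻¹ G.∙ f x G.⁻¹
            ≈⟨ G.∙-congʳ (G.assoc _ _ _) ⟩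
          f x G.∙ (f (h ▷ y) G.∙ g h G.∙ g h G.⁻¹) G.∙ f x G.⁻¹
            ≈⟨ G.∙-congʳ (G.∙-congˡ (//-rightDividesʳ (g h) (f (h ▷ y)))) ⟩
          f x G.∙ f (h ▷ y) G.∙ f x G.⁻¹
            ≈⟨ G.∙-cong (f.homo x (h ▷ y)) (⁻¹-homo N G f.isMagmaHomomorphism x) ⟨
          f (x N.∙ h ▷ y) G.∙ f (x N.⁻¹)
            ≈⟨ f.homo _ _ ⟨
          f (x N.∙ h ▷ y N.∙ x N.⁻¹) ∎))

-- 3-cycles and their adjacency

abstract
  avoid : m < n → (h : Fin m → Fin n) → ∃[ x ] (∀ i → x ≢ h i)
  avoid {m} {n} m<n h with any? (λ x → all? (λ i → ¬? (x ≟ h i)))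
  ... | yes found = found
  ... | no ¬found = contradiction (injective⇒≤ index-injective) (<⇒≱ m<n)
    where
    covered : ∀ x → ∃[ i ] x ≡ h i
    covered x with i , p ← ¬∀⟶∃¬ m _ (λ i → ¬? (x ≟ h i)) (λ avoids → ¬found (x , avoids)) =
      i , decidable-stable (x ≟ h i) p
    index-injective : Injective _≡_ _≡_ (proj₁ ∘ covered)
    index-injective {x} {y} p =
      trans (proj₂ (covered x)) (trans (cong h p) (sym (proj₂ (covered y))))

  fresh : 5 ≤ n → (a b c d : Fin n) → ∃[ x ] x ≢ a × x ≢ b × x ≢ c × x ≢ d
  fresh 5≤n a b c d with x , avoids ← avoid 5≤n (lookup (a ∷ b ∷ c ∷ d ∷ [])) =
    x , avoids 0F , avoids 1F , avoids 2F , avoids 3F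

  injective⇒permutation : (g : Fin n → Fin n) → Injective _≡_ _≡_ g →
                          ∃[ π ] (∀ x → π ⟨$⟩ʳ x ≡ g x)
  injective⇒permutation {zero} g g-injective = Perm.id , λ ()
  injective⇒permutation {suc n} g g-injective =
    Perm.permutation g (proj₁ ∘ preimage) (proj₂ ∘ preimage)
      (λ x → g-injective (proj₂ (preimage (g x)))) , λ _ → refl
    where
    preimage : ∀ y → ∃[ x ] g x ≡ y
    preimage y with any? (λ x → g x ≟ y)
    ... | yes found = found
    ... | no ¬found = contradiction
      (λ {x} {x′} p → g-injective (punchOut-injective (y≢g x) (y≢g x′) p))
      (<⇒notInjective {f = λ x → punchOut (y≢g x)} ≤-refl)
      where
      y≢g : ∀ x → y ≢ g x
      y≢g x y≡gx = ¬found (x , sym y≡gx)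

⟨$⟩ʳ-injective : (σ : Permutation′ n) → σ ⟨$⟩ʳ x ≡ σ ⟨$⟩ʳ y → x ≡ y
⟨$⟩ʳ-injective σ p = trans (sym (Perm.inverseˡ σ)) (trans (cong (σ ⟨$⟩ˡ_) p) (Perm.inverseˡ σ))

⟨$⟩ˡ-unique : (σ : Permutation′ n) → σ ⟨$⟩ʳ x ≡ y → σ ⟨$⟩ˡ y ≡ x
⟨$⟩ˡ-unique σ refl = Perm.inverseˡ σ

record Cycle {n} (σ : Permutation′ n) (a b c : Fin n) : Set where
  constructor cycle
  field
    a≢b   : a ≢ b
    b≢c   : b ≢ c
    c≢a   : c ≢ a
    a↦b   : σ ⟨$⟩ʳ a ≡ b
    b↦c   : σ ⟨$⟩ʳ b ≡ c
    c↦a   : σ ⟨$⟩ʳ c ≡ a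
    fixes : ∀ x → x ≢ a → x ≢ b → x ≢ c → σ ⟨$⟩ʳ x ≡ x

open Cycle

rotate : Cycle σ a b c → Cycle σ b c a
rotate (cycle a≢b b≢c c≢a a↦b b↦c c↦a fixes) =
  cycle b≢c c≢a a≢b b↦c c↦a a↦b (λ x p q r → fixes x r p q)

Cycle⇒IsThreeCycle : Cycle σ a b c → IsThreeCycle σ
Cycle⇒IsThreeCycle (cycle a≢b b≢c c≢a a↦b b↦c c↦a fixes) =
  threeCycle a≢b b≢c c≢a a↦b b↦c c↦a fixes

IsThreeCycle⇒Cycle : IsThreeCycle σ → ∃[ a ] ∃[ b ] ∃[ c ] Cycle σ a b c
IsThreeCycle⇒Cycle (threeCycle i≢j j≢k k≢i i↦j j↦k k↦i fixes) =
  _ , _ , _ , cycle i≢j j≢k k≢i i↦j j↦k k↦i fixes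

Cycle-resp : σ Perm.≈ τ → Cycle σ a b c → Cycle τ a b c
Cycle-resp σ≈τ (cycle a≢b b≢c c≢a a↦b b↦c c↦a fixes) =
  cycle a≢b b≢c c≢a (trans (sym (σ≈τ _)) a↦b) (trans (sym (σ≈τ _)) b↦c)
    (trans (sym (σ≈τ _)) c↦a) (λ x p q r → trans (sym (σ≈τ x)) (fixes x p q r))

IsThreeCycle-resp : σ Perm.≈ τ → IsThreeCycle σ → IsThreeCycle τ
IsThreeCycle-resp σ≈τ three with _ , _ , _ , S ← IsThreeCycle⇒Cycle three =
  Cycle⇒IsThreeCycle (Cycle-resp σ≈τ S)

data Position {n} (a b c : Fin n) : Fin n → Set where
  1st   : Position a b c a
  2nd   : Position a b c b
  3rd   : Position a b c c
  other : x ≢ a → x ≢ b → x ≢ c → Position a b c x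

position : ∀ (a b c x : Fin n) → Position a b c x
position a b c x with x ≟ a | x ≟ b | x ≟ c
... | yes refl | _        | _        = 1st
... | no _     | yes refl | _        = 2nd
... | no _     | no _     | yes refl = 3rd
... | no x≢a   | no x≢b   | no x≢c   = other x≢a x≢b x≢c

Cycle-unique : Cycle σ a b c → Cycle τ a b c → σ Perm.≈ τ
Cycle-unique {a = a} {b} {c} S T x with position a b c x
... | 1st = trans (a↦b S) (sym (a↦b T))
... | 2nd = trans (b↦c S) (sym (b↦c T))
... | 3rd = trans (c↦a S) (sym (c↦a T))
... | other p q r = trans (fixes S x p q r) (sym (fixes T x p q r))

Cycle-cubed : Cycle σ a b c → ∀ x → σ ⟨$⟩ʳ (σ ⟨$⟩ʳ (σ ⟨$⟩ʳ x)) ≡ x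
Cycle-cubed {σ = σ} {a} {b} {c} S x with position a b c x
... | 1st rewrite a↦b S | b↦c S = c↦a S
... | 2nd rewrite b↦c S | c↦a S = a↦b S
... | 3rd rewrite c↦a S | a↦b S = b↦c S
... | other p q r rewrite fixes S x p q r | fixes S x p q r = fixes S x p q r

Cycle-flip : Cycle σ a b c → Cycle (Perm.flip σ) b a c
Cycle-flip {σ = σ} (cycle a≢b b≢c c≢a a↦b b↦c c↦a fixes) =
  cycle (≢-sym a≢b) (≢-sym c≢a) (≢-sym b≢c)
    (⟨$⟩ˡ-unique σ a↦b) (⟨$⟩ˡ-unique σ c↦a) (⟨$⟩ˡ-unique σ b↦c)
    (λ x p q r → ⟨$⟩ˡ-unique σ (fixes x q p r))

Cycle-conjugate : (π : Permutation′ n) → Cycle σ a b c →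
  Cycle (Perm.flip π ∘ₚ σ ∘ₚ π) (π ⟨$⟩ʳ a) (π ⟨$⟩ʳ b) (π ⟨$⟩ʳ c)
Cycle-conjugate {σ = σ} π (cycle a≢b b≢c c≢a a↦b b↦c c↦a fixes) =
  cycle (a≢b ∘ ⟨$⟩ʳ-injective π) (b≢c ∘ ⟨$⟩ʳ-injective π) (c≢a ∘ ⟨$⟩ʳ-injective π)
    (maps a↦b) (maps b↦c) (maps c↦a)
    (λ x p q r → trans
      (cong (π ⟨$⟩ʳ_) (fixes (π ⟨$⟩ˡ x) (away p) (away q) (away r))) (Perm.inverseʳ π))
  where
  maps : σ ⟨$⟩ʳ x ≡ y → π ⟨$⟩ʳ (σ ⟨$⟩ʳ (π ⟨$⟩ˡ (π ⟨$⟩ʳ x))) ≡ π ⟨$⟩ʳ y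
  maps p = cong (π ⟨$⟩ʳ_) (trans (cong (σ ⟨$⟩ʳ_) (Perm.inverseˡ π)) p)
  away : x ≢ π ⟨$⟩ʳ y → π ⟨$⟩ˡ x ≢ y
  away p refl = p (sym (Perm.inverseʳ π))

Arrow : Permutation′ n → Fin n → Fin n → Set
Arrow σ p q = p ≢ q × σ ⟨$⟩ʳ p ≡ q

data ArcPosition (a b c : Fin n) : Fin n → Fin n → Set where
  1st : ArcPosition a b c a b
  2nd : ArcPosition a b c b c
  3rd : ArcPosition a b c c a

arrow : Cycle σ a b c → Arrow σ p q → ArcPosition a b c p q
arrow {a = a} {b} {c} {p} S (p≢q , p↦q) with position a b c p
... | 1st with refl ← trans (sym (a↦b S)) p↦q = 1st
... | 2nd with refl ← trans (sym (b↦c S)) p↦q = 2nd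
... | 3rd with refl ← trans (sym (c↦a S)) p↦q = 3rd
... | other u v w = contradiction (trans (sym (fixes S p u v w)) p↦q) p≢q

abstract
  startAt : IsThreeCycle σ → Arrow σ p q → ∃[ r ] Cycle σ p q r
  startAt three ar with _ , _ , _ , S ← IsThreeCycle⇒Cycle three | arrow S ar
  ... | 1st = _ , S
  ... | 2nd = _ , rotate S
  ... | 3rd = _ , rotate (rotate S)

  arrows-meet : IsThreeCycle σ → Arrow σ a b → Arrow σ c d → a ≡ c ⊎ b ≡ c ⊎ d ≡ a
  arrows-meet three f g with _ , S ← startAt three f | arrow S g
  ... | 1st = inj₁ refl
  ... | 2nd = inj₂ (inj₁ refl)
  ... | 3rd = inj₂ (inj₂ refl)

  not-swapped : IsThreeCycle σ → Arrow σ a b → ¬ Arrow σ b a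
  not-swapped three f g with _ , S ← startAt three f | arrow S g
  ... | 1st = a≢b S refl
  ... | 2nd = c≢a S refl
  ... | 3rd = b≢c S refl

  two-arrows⇒≈ : IsThreeCycle σ → IsThreeCycle τ → a ≢ c →
    Arrow σ a b → Arrow τ a b → Arrow σ c d → Arrow τ c d → σ Perm.≈ τ
  two-arrows⇒≈ s t a≢c f f′ g g′
    with _ , S ← startAt s f | _ , T ← startAt t f′ | arrow S g | arrow T g′
  ... | 1st | _   = contradiction refl a≢c
  ... | 2nd | 1st = contradiction refl a≢c
  ... | 2nd | 2nd = Cycle-unique S T
  ... | 2nd | 3rd = contradiction refl (c≢a S)
  ... | 3rd | 1st = contradiction refl a≢c
  ... | 3rd | 2nd = contradiction refl (b≢c S)
  ... | 3rd | 3rd = Cycle-unique S T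

-- Adjacency in CAG n, without the parities.
Adj : Permutation′ n → Permutation′ n → Set
Adj σ τ = ∃[ υ ] IsThreeCycle υ × (∀ x → τ ⟨$⟩ʳ x ≡ σ ⟨$⟩ʳ (υ ⟨$⟩ʳ x))

abstract
  Adj-irreflexive : Adj σ τ → ¬ (σ Perm.≈ τ)
  Adj-irreflexive {σ = σ} (υ , three , p) σ≈τ with a , b , c , U ← IsThreeCycle⇒Cycle three =
    a≢b U (trans (⟨$⟩ʳ-injective σ (trans (σ≈τ a) (p a))) (a↦b U))

Common : Permutation′ n → Permutation′ n → Set
Common σ τ = ∃₂ λ p q → Arrow σ p q × Arrow τ p q

Opposite : Permutation′ n → Permutation′ n → Set
Opposite σ τ = ∀ x → σ ⟨$⟩ʳ (τ ⟨$⟩ʳ x) ≡ x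

abstract
  Opposite-sym : Opposite σ τ → Opposite τ σ
  Opposite-sym {σ = σ} opp x = ⟨$⟩ʳ-injective σ (opp (σ ⟨$⟩ʳ x))

  opposite-↦ : Opposite σ τ → σ ⟨$⟩ʳ x ≡ y → τ ⟨$⟩ʳ y ≡ x
  opposite-↦ {σ = σ} opp refl = ⟨$⟩ʳ-injective σ (opp _)

  adj⇒ : IsThreeCycle σ → IsThreeCycle τ → Adj σ τ → Common σ τ ⊎ Opposite σ τ
  adj⇒ {σ = σ} {τ} s t (υ , u , τ≈) with a , b , c , S ← IsThreeCycle⇒Cycle s
    = go (υ ⟨$⟩ʳ a ≟ a) (υ ⟨$⟩ʳ b ≟ b) (υ ⟨$⟩ʳ c ≟ c)
    where
    fixed : Arrow σ x y → υ ⟨$⟩ʳ x ≡ x → Common σ τ ⊎ Opposite σ τ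
    fixed f p = inj₁ (_ , _ , f , proj₁ f , trans (τ≈ _) (trans (cong (σ ⟨$⟩ʳ_) p) (proj₂ f)))

    same : Cycle υ a b c → Opposite σ τ
    same U x = trans (cong (σ ⟨$⟩ʳ_) (trans (τ≈ x) (cong (σ ⟨$⟩ʳ_) (Cycle-unique U S x))))
      (Cycle-cubed S x)

    inverse : ¬ Cycle υ a c b
    inverse U with i , j , _ , T ← IsThreeCycle⇒Cycle t =
      a≢b T (trans
        (sym (trans (cong (σ ⟨$⟩ʳ_) (Cycle-unique U (rotate (Cycle-flip S)) i)) (Perm.inverseʳ σ)))
        (trans (sym (τ≈ i)) (a↦b T)))

    go : Dec (υ ⟨$⟩ʳ a ≡ a) → Dec (υ ⟨$⟩ʳ b ≡ b) → Dec (υ ⟨$⟩ʳ c ≡ c) →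
         Common σ τ ⊎ Opposite σ τ
    go (yes p) _ _ = fixed (a≢b S , a↦b S) p
    go _ (yes p) _ = fixed (b≢c S , b↦c S) p
    go _ _ (yes p) = fixed (c≢a S , c↦a S) p
    go (no p) (no q) (no r) with _ , U ← startAt u (≢-sym p , refl) =
      moved U (≢-sym q , refl) (≢-sym r , refl)
      where
      moved : ∀ {p q} → Cycle υ a x y → Arrow υ b p → Arrow υ c q → Common σ τ ⊎ Opposite σ τ
      moved U f g with arrow U f | arrow U g
      ... | 1st | _   = contradiction refl (a≢b S)
      ... | 2nd | 1st = contradiction refl (c≢a S)
      ... | 2nd | 2nd = contradiction refl (b≢c S)
      ... | 2nd | 3rd = inj₂ (same U)
      ... | 3rd | 1st = contradiction refl (c≢a S)
      ... | 3rd | 2nd = contradiction U inverse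
      ... | 3rd | 3rd = contradiction refl (b≢c S)

  share⇒adj : Cycle σ a b c → Cycle τ a b d → c ≢ d → Adj σ τ
  share⇒adj {σ = σ} {a} {b} {c} {τ} {d} S T c≢d =
    τ ∘ₚ Perm.flip σ , Cycle⇒IsThreeCycle U , λ x → sym (Perm.inverseʳ σ)
    where
    U : Cycle (τ ∘ₚ Perm.flip σ) b d c
    U = cycle (b≢c T) (≢-sym c≢d) (≢-sym (b≢c S))
      (trans (cong (σ ⟨$⟩ˡ_) (b↦c T))
        (⟨$⟩ˡ-unique σ (fixes S d (c≢a T) (≢-sym (b≢c T)) (≢-sym c≢d))))
      (trans (cong (σ ⟨$⟩ˡ_) (c↦a T)) (⟨$⟩ˡ-unique σ (c↦a S)))
      (trans (cong (σ ⟨$⟩ˡ_) (fixes T c (c≢a S) (≢-sym (b≢c S)) c≢d)) (⟨$⟩ˡ-unique σ (b↦c S)))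
      fix
      where
      fix : ∀ x → x ≢ b → x ≢ d → x ≢ c → σ ⟨$⟩ˡ (τ ⟨$⟩ʳ x) ≡ x
      fix x x≢b x≢d x≢c with x ≟ a
      ... | yes refl = ⟨$⟩ˡ-unique σ (trans (a↦b S) (sym (a↦b T)))
      ... | no x≢a   = trans (cong (σ ⟨$⟩ˡ_) (fixes T x x≢a x≢b x≢d))
        (⟨$⟩ˡ-unique σ (fixes S x x≢a x≢b x≢c))

  common⇒adj : IsThreeCycle σ → IsThreeCycle τ → Common σ τ → ¬ (σ Perm.≈ τ) → Adj σ τ
  common⇒adj s t (_ , _ , f , g) σ≉τ with _ , S ← startAt s f | _ , T ← startAt t g =
    share⇒adj S T λ { refl → σ≉τ (Cycle-unique S T) }

  opposite⇒adj : IsThreeCycle σ → Opposite σ τ → Adj σ τ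
  opposite⇒adj {σ = σ} s opp with _ , _ , _ , S ← IsThreeCycle⇒Cycle s =
    σ , s , λ x → ⟨$⟩ʳ-injective σ (trans (opp x) (sym (Cycle-cubed S x)))

  triangle : IsThreeCycle σ → IsThreeCycle τ → IsThreeCycle υ → ¬ (σ Perm.≈ τ) →
    Arrow σ p q → Arrow τ p q → Adj σ υ → Adj τ υ → Arrow υ p q
  triangle {σ = σ} {τ} {υ} {p} {q} s t u σ≉τ f g σ~υ τ~υ
    with c , S ← startAt s f | d , T ← startAt t g = go (adj⇒ s u σ~υ) (adj⇒ t u τ~υ)
    where
    c≢d : c ≢ d
    c≢d refl = σ≉τ (Cycle-unique S T)

    half : ∀ {σ τ c d} → Cycle σ p q c → Cycle τ p q d → c ≢ d →
           Opposite σ υ → Common τ υ → Arrow υ p q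
    half {σ} S T c≢d opp (_ , _ , h , h′) with arrow T h
    ... | 1st = h′
    ... | 2nd = contradiction
      (trans (sym (opposite-↦ {σ = σ} {υ} opp (a↦b S))) (proj₂ h′)) (≢-sym (c≢a T))
    ... | 3rd = contradiction
      (⟨$⟩ʳ-injective υ (trans (proj₂ h′) (sym (opposite-↦ {σ = σ} {υ} opp (a↦b S)))))
      (≢-sym (b≢c T))

    go : Common σ υ ⊎ Opposite σ υ → Common τ υ ⊎ Opposite τ υ → Arrow υ p q
    go (inj₂ opp) (inj₁ com) = half S T c≢d opp com
    go (inj₁ com) (inj₂ opp) = half T S (≢-sym c≢d) opp com
    go (inj₂ opp) (inj₂ opp′) = contradiction
      (λ x → trans (cong (σ ⟨$⟩ʳ_) (sym (Opposite-sym {σ = τ} {υ} opp′ x))) (opp (τ ⟨$⟩ʳ x))) σ≉τ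
    go (inj₁ (_ , _ , h , h′)) (inj₁ (_ , _ , k , k′)) with arrow S h | arrow T k
    ... | 1st | _   = h′
    ... | 2nd | 1st = k′
    ... | 3rd | 1st = k′
    ... | 2nd | 2nd = contradiction (trans (sym (proj₂ h′)) (proj₂ k′)) c≢d
    ... | 3rd | 3rd = contradiction (⟨$⟩ʳ-injective υ (trans (proj₂ h′) (sym (proj₂ k′)))) c≢d
    ... | 2nd | 3rd with arrows-meet u h′ k′
    ...   | inj₁ e        = contradiction e (b≢c T)
    ...   | inj₂ (inj₁ e) = contradiction e c≢d
    ...   | inj₂ (inj₂ e) = contradiction e (a≢b S)
    go (inj₁ (_ , _ , h , h′)) (inj₁ (_ , _ , k , k′)) | 3rd | 2nd with arrows-meet u h′ k′
    ...   | inj₁ e        = contradiction e (≢-sym (b≢c S))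
    ...   | inj₂ (inj₁ e) = contradiction e (a≢b S)
    ...   | inj₂ (inj₂ e) = contradiction e (≢-sym c≢d)

  opposite-no-common-neighbour : IsThreeCycle σ → IsThreeCycle τ → IsThreeCycle υ →
    Opposite σ τ → Adj σ υ → ¬ Adj τ υ
  opposite-no-common-neighbour {σ = σ} {τ} {υ} s t u opp σ~υ τ~υ =
    go (adj⇒ s u σ~υ) (adj⇒ t u τ~υ)
    where
    go : Common σ υ ⊎ Opposite σ υ → Common τ υ ⊎ Opposite τ υ → ⊥
    go (inj₂ opp′) _ = Adj-irreflexive {σ = τ} {υ} τ~υ
      (λ x → ⟨$⟩ʳ-injective σ (trans (opp x) (sym (opp′ x))))
    go _ (inj₂ opp′) = Adj-irreflexive {σ = σ} {υ} σ~υ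
      (λ x → ⟨$⟩ʳ-injective τ (trans (Opposite-sym {σ = σ} {τ} opp x) (sym (opp′ x))))
    go (inj₁ (_ , _ , f , f′)) (inj₁ (_ , _ , g , g′)) with c , S ← startAt s f
      with arrow (Cycle-resp {σ = Perm.flip σ} {τ} (λ x → ⟨$⟩ˡ-unique σ (opp x)) (Cycle-flip S)) g
    ... | 1st = not-swapped u f′ g′
    ... | 2nd = b≢c S (trans (sym (proj₂ f′)) (proj₂ g′))
    ... | 3rd = c≢a S (⟨$⟩ʳ-injective υ (trans (proj₂ g′) (sym (proj₂ f′))))

transpose-fst : ∀ (a b : Fin n) → PC.transpose a b a ≡ b
transpose-fst a b with a ≟ a
... | yes _ = refl
... | no ¬p = contradiction refl ¬p

transpose-snd : ∀ (a b : Fin n) → PC.transpose a b b ≡ a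
transpose-snd a b with b ≟ a
... | yes p = p
... | no _ with b ≟ b
...   | yes _ = refl
...   | no ¬p = contradiction refl ¬p

transpose-other : x ≢ a → x ≢ b → PC.transpose a b x ≡ x
transpose-other {x = x} {a} {b} x≢a x≢b with x ≟ a
... | yes p = contradiction p x≢a
... | no  _ with x ≟ b
...   | yes p = contradiction p x≢b
...   | no  _ = refl

transpose²-cycle : a ≢ b → b ≢ c → c ≢ a → Cycle (transpose a b ∘ₚ transpose b c) a c b
transpose²-cycle {a = a} {b} {c} a≢b b≢c c≢a = cycle (≢-sym c≢a) (≢-sym b≢c) (≢-sym a≢b)
  (trans (cong (PC.transpose b c) (transpose-fst a b)) (transpose-fst b c))
  (trans (cong (PC.transpose b c) (transpose-other c≢a (≢-sym b≢c))) (transpose-snd b c))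
  (trans (cong (PC.transpose b c) (transpose-snd a b)) (transpose-other a≢b (≢-sym c≢a)))
  (λ x x≢a x≢c x≢b → trans (cong (PC.transpose b c) (transpose-other x≢a x≢b))
    (transpose-other x≢b x≢c))

-- The action on arcs

-- B is the graph of a pair of functions such that any two arguments agree in
-- exactly one of them; if two arguments agree in the first, so do all.
constant : {B : Fin n → Fin n → Fin n → Set} →
  (∀ {x p q p′ q′} → B x p q → B x p′ q′ → p ≡ p′) →
  (∀ {x y p q p′ q′} → x ≢ y → B x p q → B y p′ q′ → p ≡ p′ ⊎ q ≡ q′) →
  (∀ {x y p q} → x ≢ y → B x p q → ¬ B y p q) →
  ∀ {x y p q r} → x ≢ y → B x p q → B y p r → ∀ {z p′ q′} → B z p′ q′ → p ≡ p′
constant unique meet apart {x} {y} x≢y X Y {z} Z with z ≟ x | z ≟ y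
... | yes refl | _        = unique X Z
... | no _     | yes refl = unique Y Z
... | no z≢x   | no z≢y with meet (≢-sym z≢x) X Z | meet (≢-sym z≢y) Y Z
...   | inj₁ e    | _         = e
...   | inj₂ _    | inj₁ e    = e
...   | inj₂ refl | inj₂ refl = contradiction Y (apart x≢y X)

induced : {B : (a b p q : Fin n) → Set} →
  (∀ {a b} → a ≢ b → ∃₂ (B a b)) →
  (∀ {a b p q} → B a b p q → B b a q p) →
  (∀ {a b p q} → B a b p q → p ≢ q) →
  (∀ a → ∃[ p ] ∀ {b p′ q′} → B a b p′ q′ → p ≡ p′) →
  ∃[ π ] (∀ {a b} → a ≢ b → B a b (π ⟨$⟩ʳ a) (π ⟨$⟩ʳ b))
induced {n} {B} exists reverse target≢ tails = go (injective⇒permutation g g-injective)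
  where
  g : Fin n → Fin n
  g a = proj₁ (tails a)

  spec : ∀ {a b} → a ≢ b → B a b (g a) (g b)
  spec {a} {b} a≢b with exists a≢b
  ... | p , q , F = subst₂ (B a b) (sym (proj₂ (tails a) F))
    (sym (proj₂ (tails b) (reverse F))) F

  g-injective : Injective _≡_ _≡_ g
  g-injective {a} {b} p with a ≟ b
  ... | yes a≡b = a≡b
  ... | no a≢b  = contradiction p (target≢ (spec a≢b))

  go : ∃[ π ] (∀ x → π ⟨$⟩ʳ x ≡ g x) →
       ∃[ π ] (∀ {a b} → a ≢ b → B a b (π ⟨$⟩ʳ a) (π ⟨$⟩ʳ b))
  go (π , π≡g) = π , λ {a} {b} a≢b → subst₂ (B a b) (sym (π≡g a)) (sym (π≡g b)) (spec a≢b)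

arrows⇒Cycle : IsThreeCycle σ → Arrow σ a b → Arrow σ b c → Cycle σ a b c
arrows⇒Cycle three f g with startAt three f
... | _ , S with refl ← trans (sym (b↦c S)) (proj₂ g) = S

-- The family perm enumerates the 3-cycles, and perm v ↦ img v is an automorphism
-- of the graph they span.
module Neighbourhood {n} (5≤n : 5 ≤ n) {V : Set} (perm img : V → Permutation′ n)
  (perm-threeCycle : ∀ v → IsThreeCycle (perm v))
  (img-threeCycle  : ∀ v → IsThreeCycle (img v))
  (perm-surjective : ∀ {σ} → IsThreeCycle σ → ∃[ v ] perm v Perm.≈ σ)
  (img-surjective  : ∀ {σ} → IsThreeCycle σ → ∃[ v ] img v Perm.≈ σ)
  (img-cong        : ∀ u v → perm u Perm.≈ perm v → img u Perm.≈ img v)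
  (img-injective   : ∀ u v → img u Perm.≈ img v → perm u Perm.≈ perm v)
  (img-adj         : ∀ u v → Adj (perm u) (perm v) → Adj (img u) (img v))
  (img-adj⁻        : ∀ u v → Adj (img u) (img v) → Adj (perm u) (perm v))
  where

  abstract
    permCycle : a ≢ b → b ≢ c → c ≢ a → ∃[ v ] Cycle (perm v) a b c
    permCycle a≢b b≢c c≢a
      with C ← transpose²-cycle (≢-sym c≢a) (≢-sym b≢c) (≢-sym a≢b)
      with v , p ← perm-surjective (Cycle⇒IsThreeCycle C) = v , Cycle-resp (λ x → sym (p x)) C

    imgCycle : a ≢ b → b ≢ c → c ≢ a → ∃[ v ] Cycle (img v) a b c
    imgCycle a≢b b≢c c≢a
      with C ← transpose²-cycle (≢-sym c≢a) (≢-sym b≢c) (≢-sym a≢b)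
      with v , p ← img-surjective (Cycle⇒IsThreeCycle C) = v , Cycle-resp (λ x → sym (p x)) C

    img-opposite : ∀ u v → Opposite (perm u) (perm v) → Opposite (img u) (img v)
    img-opposite u v opp
      with adj⇒ (img-threeCycle u) (img-threeCycle v)
        (img-adj u v (opposite⇒adj {τ = perm v} (perm-threeCycle u) opp))
    ... | inj₂ opp′ = opp′
    ... | inj₁ (p , q , g , h)
      with r , S ← startAt (img-threeCycle u) g | r′ , T ← startAt (img-threeCycle v) h
      with x , x≢p , x≢q , x≢r , x≢r′ ← fresh 5≤n p q r r′
      with w , U ← imgCycle (a≢b S) (≢-sym x≢q) x≢p =
      contradiction (img-adj⁻ v w (share⇒adj T U (≢-sym x≢r′)))
        (opposite-no-common-neighbour
          (perm-threeCycle u) (perm-threeCycle v) (perm-threeCycle w) opp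
          (img-adj⁻ u w (share⇒adj S U (≢-sym x≢r))))

  record Arc (a b p q : Fin n) : Set where
    constructor arc
    field
      source≢ : a ≢ b
      target≢ : p ≢ q
      carries : ∀ {c} u → Cycle (perm u) a b c → img u ⟨$⟩ʳ p ≡ q

  open Arc

  image : ∀ u → Arc a b p q → Cycle (perm u) a b c → Arrow (img u) p q
  image u F C = target≢ F , carries F u C

  img-≉ : ∀ u v → Cycle (perm u) a b c → Cycle (perm v) a b d → c ≢ d → ¬ (img u Perm.≈ img v)
  img-≉ u v C D c≢d p = c≢d (trans (sym (b↦c C)) (trans (img-injective u v p _) (b↦c D)))

  abstract
    arc-exists : a ≢ b → ∃₂ (Arc a b)
    arc-exists {a} {b} a≢b
      with c , c≢a , c≢b , _ ← fresh 5≤n a b a b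
      with d , d≢a , d≢b , d≢c , _ ← fresh 5≤n a b c c
      with e , e≢a , e≢b , e≢c , e≢d ← fresh 5≤n a b c d
      with u , C ← permCycle a≢b (≢-sym c≢b) c≢a
         | v , D ← permCycle a≢b (≢-sym d≢b) d≢a
         | w , E ← permCycle a≢b (≢-sym e≢b) e≢a
      with adj⇒ (img-threeCycle u) (img-threeCycle v) (img-adj u v (share⇒adj C D (≢-sym d≢c)))
    ... | inj₂ opp = contradiction (img-adj v w (share⇒adj D E (≢-sym e≢d)))
      (opposite-no-common-neighbour (img-threeCycle u) (img-threeCycle v) (img-threeCycle w) opp
        (img-adj u w (share⇒adj C E (≢-sym e≢c))))
    ... | inj₁ (p , q , g , h) = p , q , arc a≢b (proj₁ g) carry
      where
      carry : ∀ {x} t → Cycle (perm t) a b x → img t ⟨$⟩ʳ p ≡ q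
      carry {x} t X with x ≟ c | x ≟ d
      ... | yes refl | _        = trans (img-cong t u (Cycle-unique X C) p) (proj₂ g)
      ... | no _     | yes refl = trans (img-cong t v (Cycle-unique X D) p) (proj₂ h)
      ... | no x≢c   | no x≢d   = proj₂ (triangle
        (img-threeCycle u) (img-threeCycle v) (img-threeCycle t)
        (img-≉ u v C D (≢-sym d≢c)) g h
        (img-adj u t (share⇒adj C X (≢-sym x≢c))) (img-adj v t (share⇒adj D X (≢-sym x≢d))))

    arc-unique : Arc a b p q → Arc a b p′ q′ → p ≡ p′ × q ≡ q′
    arc-unique {a} {b} {p} {q} {p′} {q′} F G
      with c , c≢a , c≢b , _ ← fresh 5≤n a b a b
      with d , d≢a , d≢b , d≢c , _ ← fresh 5≤n a b c c
      with u , C ← permCycle (source≢ F) (≢-sym c≢b) c≢a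
         | v , D ← permCycle (source≢ F) (≢-sym d≢b) d≢a
      with p ≟ p′
    ... | yes refl = refl , trans (sym (carries F u C)) (carries G u C)
    ... | no p≢p′  = contradiction
      (two-arrows⇒≈ (img-threeCycle u) (img-threeCycle v) p≢p′
        (image u F C) (image v F D) (image u G C) (image v G D))
      (img-≉ u v C D (≢-sym d≢c))

    arc-reverse : Arc a b p q → Arc b a q p
    arc-reverse {a} {b} {p} {q} F = arc (≢-sym (source≢ F)) (≢-sym (target≢ F)) reversed
      where
      reversed : ∀ {c} v → Cycle (perm v) b a c → img v ⟨$⟩ʳ q ≡ p
      reversed v D with u , C ← permCycle (≢-sym (a≢b D)) (≢-sym (c≢a D)) (≢-sym (b≢c D)) =
        opposite-↦ {σ = img u} {img v} (img-opposite u v opp) (carries F u C)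
        where
        opp : Opposite (perm u) (perm v)
        opp x = trans (cong (perm u ⟨$⟩ʳ_) (Cycle-unique D (Cycle-flip C) x))
          (Perm.inverseʳ (perm u))

    arcs-differ : c ≢ a → Arc a b p q → ¬ Arc b c p q
    arcs-differ {c} {a} {b} c≢a F G
      with d , d≢a , d≢b , d≢c , _ ← fresh 5≤n a b c c
      with u , C ← permCycle (source≢ F) (≢-sym d≢b) d≢a
         | v , D ← permCycle (source≢ G) (≢-sym d≢c) d≢b
      with adj⇒ (perm-threeCycle u) (perm-threeCycle v)
        (img-adj⁻ u v (common⇒adj (img-threeCycle u) (img-threeCycle v)
          (_ , _ , image u F C , image v G D)
          λ p → source≢ F (trans (sym (fixes D a (source≢ F) (≢-sym c≢a) (≢-sym d≢a)))
            (trans (sym (img-injective u v p a)) (a↦b C)))))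
    ... | inj₂ opp = c≢a (trans (sym (opp c)) (trans (cong (perm u ⟨$⟩ʳ_) (b↦c D)) (c↦a C)))
    ... | inj₁ (_ , _ , g , h) with arrow C g | arrow D h
    ...   | 1st | 1st = source≢ F refl
    ...   | 1st | 2nd = c≢a refl
    ...   | 1st | 3rd = d≢a refl
    ...   | 2nd | 1st = d≢c refl
    ...   | 2nd | 2nd = source≢ G refl
    ...   | 2nd | 3rd = d≢b refl
    ...   | 3rd | 1st = c≢a refl
    ...   | 3rd | 2nd = d≢c refl
    ...   | 3rd | 3rd = source≢ F refl

    meet : b ≢ c → Arc a b p q → Arc a c p′ q′ → p ≡ p′ ⊎ q ≡ q′
    meet b≢c F G with u , C ← permCycle (≢-sym (source≢ F)) (source≢ G) (≢-sym b≢c)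
      with arrows-meet (img-threeCycle u) (image u (arc-reverse F) C) (image u G (rotate C))
    ... | inj₁ refl = contradiction
          (subst (Arc _ _ _) (trans (sym (carries G u (rotate C))) (carries (arc-reverse F) u C)) G)
          (arcs-differ (≢-sym b≢c) (arc-reverse F))
    ... | inj₂ (inj₁ e) = inj₁ e
    ... | inj₂ (inj₂ e) = inj₂ (sym e)

    apart : b ≢ c → Arc a b p q → ¬ Arc a c p q
    apart b≢c F G with u , C ← permCycle (≢-sym (source≢ F)) (source≢ G) (≢-sym b≢c) =
      not-swapped (img-threeCycle u) (image u G (rotate C)) (image u (arc-reverse F) C)

  CommonTail CommonHead : Fin n → Fin n → Set
  CommonTail a p = ∀ {b p′ q′} → Arc a b p′ q′ → p ≡ p′
  CommonHead a q = ∀ {b p′ q′} → Arc a b p′ q′ → q ≡ q′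

  abstract
    TwoArcs : Fin n → Set
    TwoArcs a = ∃₂ λ b c → b ≢ c × ∃₂ (Arc a b) × ∃₂ (Arc a c)

    two-arcs : ∀ a → TwoArcs a
    two-arcs a
      with b , b≢a , _ ← fresh 5≤n a a a a
      with c , c≢a , c≢b , _ ← fresh 5≤n a b a b =
      b , c , ≢-sym c≢b , arc-exists (≢-sym b≢a) , arc-exists (≢-sym c≢a)

    common : ∀ a → ∃ (CommonTail a) ⊎ ∃ (CommonHead a)
    common a = go (two-arcs a)
      where
      choose : b ≢ c → Arc a b p q → Arc a c p′ q′ → p ≡ p′ ⊎ q ≡ q′ →
               ∃ (CommonTail a) ⊎ ∃ (CommonHead a)
      choose {p = p} b≢c F G (inj₁ refl) = inj₁ (p , constant {B = Arc a}
        (λ F G → proj₁ (arc-unique F G)) meet apart b≢c F G)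
      choose {q = q} b≢c F G (inj₂ refl) = inj₂ (q , constant {B = λ b q p → Arc a b p q}
        (λ F G → proj₂ (arc-unique F G)) (λ ne F G → swap (meet ne F G)) apart b≢c F G)

      go : TwoArcs a → ∃ (CommonTail a) ⊎ ∃ (CommonHead a)
      go (_ , _ , b≢c , (_ , _ , F) , (_ , _ , G)) = choose b≢c F G (meet b≢c F G)

    -- Otherwise the arcs c → a and c → b, for a third vertex c, could not meet.
    mixed : a ≢ b → CommonTail a p → ¬ CommonHead b q
    mixed {a} {b} a≢b t h = go (fresh 5≤n a b a b)
      where
      clash : Arc a c p′ q′ → Arc b c x y → p′ ≡ y → q′ ≡ y ⊎ p′ ≡ x → ⊥
      clash G H e (inj₁ e′) = target≢ G (trans e (sym e′))
      clash G H e (inj₂ e′) = target≢ H (trans (sym e′) e)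

      go : ∃[ c ] (c ≢ a × c ≢ b × c ≢ a × c ≢ b) → ⊥
      go (c , c≢a , c≢b , _) =
        let _ , _ , F = arc-exists a≢b
            _ , _ , G = arc-exists (≢-sym c≢a)
            _ , _ , H = arc-exists (≢-sym c≢b)
        in clash G H (trans (sym (t G)) (trans (t F) (trans (sym (h (arc-reverse F))) (h H))))
             (meet a≢b (arc-reverse G) (arc-reverse H))

    spread-tail : CommonTail a p → ∀ b → ∃ (CommonTail b)
    spread-tail {a} {p} t b = go (a ≟ b) (common b)
      where
      go : Dec (a ≡ b) → ∃ (CommonTail b) ⊎ ∃ (CommonHead b) → ∃ (CommonTail b)
      go (yes refl) _              = p , t
      go (no _)     (inj₁ t′)      = t′
      go (no a≢b)   (inj₂ (_ , h)) = ⊥-elim (mixed a≢b t h)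

    spread-head : CommonHead a q → ∀ b → ∃ (CommonHead b)
    spread-head {a} {q} h b = go (b ≟ a) (common b)
      where
      go : Dec (b ≡ a) → ∃ (CommonTail b) ⊎ ∃ (CommonHead b) → ∃ (CommonHead b)
      go (yes refl) _              = q , h
      go (no _)     (inj₂ h′)      = h′
      go (no b≢a)   (inj₁ (_ , t)) = ⊥-elim (mixed b≢a t h)

    orientation : (∀ a → ∃ (CommonTail a)) ⊎ (∀ a → ∃ (CommonHead a))
    orientation = Sum.map (λ (_ , t) → spread-tail t) (λ (_ , h) → spread-head h)
      (common (fromℕ< (≤-trans (s≤s z≤n) 5≤n)))

  Along Against : Permutation′ n → Set
  Along   π = ∀ {a b} → a ≢ b → Arc a b (π ⟨$⟩ʳ a) (π ⟨$⟩ʳ b)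
  Against π = ∀ {a b} → a ≢ b → Arc a b (π ⟨$⟩ʳ b) (π ⟨$⟩ʳ a)

  abstract
    classification : ∃[ π ] (Along π ⊎ Against π)
    classification = go orientation
      where
      go : (∀ a → ∃ (CommonTail a)) ⊎ (∀ a → ∃ (CommonHead a)) → ∃[ π ] (Along π ⊎ Against π)
      go (inj₁ t) =
        let π , F = induced {B = Arc} arc-exists arc-reverse target≢ t
        in π , inj₁ F
      go (inj₂ h) =
        let π , F = induced {B = λ a b p q → Arc a b q p}
              (λ a≢b → let p , q , F = arc-exists a≢b in q , p , F)
              arc-reverse (λ F → ≢-sym (target≢ F))
              (λ a → let q , spec = h a in q , λ F → spec F)
        in π , inj₂ F

    along-Cycle : ∀ {π} → Along π → ∀ v → Cycle (perm v) a b c →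
      Cycle (img v) (π ⟨$⟩ʳ a) (π ⟨$⟩ʳ b) (π ⟨$⟩ʳ c)
    along-Cycle F v C =
      arrows⇒Cycle (img-threeCycle v) (image v (F (a≢b C)) C) (image v (F (b≢c C)) (rotate C))

    against-Cycle : ∀ {π} → Against π → ∀ v → Cycle (perm v) a b c →
      Cycle (img v) (π ⟨$⟩ʳ c) (π ⟨$⟩ʳ b) (π ⟨$⟩ʳ a)
    against-Cycle F v C =
      arrows⇒Cycle (img-threeCycle v) (image v (F (b≢c C)) (rotate C)) (image v (F (a≢b C)) C)

-- Rigidity

module A n = Group (A n)
module SymA n = Group (SymA n)

subst-Cycle : ∀ {a′ b′ c′} → a ≡ a′ → b ≡ b′ → c ≡ c′ → Cycle σ a b c → Cycle σ a′ b′ c′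
subst-Cycle refl refl refl S = S

module _ (Γ : Group ℓ₁ ℓ₂) {T : Pred (Group.Carrier Γ) ℓ₃} (conn : IsConnectionSet Γ T) where
  open Group Γ renaming (refl to ≈-refl; sym to ≈-sym; trans to ≈-trans)
  open GroupProperties Γ

  rightMultiplication-isAutomorphism : ∀ g → rightMultiplication Γ g ∈ IsAutomorphism (Cay Γ conn)
  rightMultiplication-isAutomorphism g α β = mk⇔
    (λ (t , t∈ , p) → t , t∈ , ≈-trans (∙-congʳ p) (assoc t α g))
    (λ (t , t∈ , p) → t , t∈ , ∙-cancelʳ g β (t ∙ α) (≈-trans p (≈-sym (assoc t α g))))

abstract
  transpose-involutive : ∀ (a b x : Fin n) → PC.transpose a b (PC.transpose a b x) ≡ x
  transpose-involutive a b x = go (x ≟ a) (x ≟ b)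
    where
    go : Dec (x ≡ a) → Dec (x ≡ b) → PC.transpose a b (PC.transpose a b x) ≡ x
    go (yes refl) _        = trans (cong (PC.transpose a b) (transpose-fst a b)) (transpose-snd a b)
    go (no _)   (yes refl) = trans (cong (PC.transpose a b) (transpose-snd a b)) (transpose-fst a b)
    go (no x≢a) (no x≢b)   = trans (cong (PC.transpose a b) (transpose-other x≢a x≢b))
                               (transpose-other x≢a x≢b)

module _ {P : Pred (A.Carrier n) ℓ₁} (P-resp : P Respects (A._≈_ n)) (P-ε : A.ε n ∈ P)
  (P-∙ : ∀ s y → s ∈ ThreeCycles n → y ∈ P → A._∙_ n s y ∈ P) where

  private
    adjacentTranspositions : ∀ {i j k} (y z : A.Carrier n) → i ≢ j → j ≢ k → y ∈ P →
      (∀ x → proj₁ y ⟨$⟩ʳ PC.transpose j k (PC.transpose i j x) ≡ proj₁ z ⟨$⟩ʳ x) → z ∈ P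
    adjacentTranspositions {i} {j} {k} y z i≢j j≢k y∈ p = go (k ≟ i)
      where
      go : Dec (k ≡ i) → z ∈ P
      go (yes refl) = P-resp {y} {z}
        (λ x → trans (cong (proj₁ y ⟨$⟩ʳ_) (sym (PC.transpose-inverse j k))) (p x)) y∈
      go (no k≢i) = P-resp {A._∙_ n s y} {z} p (P-∙ s y s∈ y∈)
        where
        s∈ : IsThreeCycle (transpose i j ∘ₚ transpose j k)
        s∈ = Cycle⇒IsThreeCycle (transpose²-cycle i≢j j≢k k≢i)
        s : A.Carrier n
        s = _ , IsThreeCycle⊆Even s∈

    evenProducts : ∀ ts → All (λ (i , j) → i ≢ j) ts → 2 ∣ length ts →
      ∀ (z : A.Carrier n) → eval ts Perm.≈ proj₁ z → z ∈ P
    evenProducts [] _ _ z p = P-resp {A.ε n} {z} p P-ε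
    evenProducts (_ ∷ []) _ 2∣1 z p = contradiction (∣⇒≤ 2∣1) (<⇒≱ ≤-refl)
    -- (i j) (k l) = (i j) (j k) · (j k) (k l), and each factor is ε or a 3-cycle.
    evenProducts ((i , j) ∷ (k , l) ∷ ts) (i≢j ∷ k≢l ∷ ts≢) even z p = go (j ≟ k)
      where
      even′ : 2 ∣ length ts
      even′ = ∣m+n∣m⇒∣n even ∣-refl
      α : A.Carrier n
      α = eval ts , ts , ts≢ , even′ , λ _ → refl
      α∈ : α ∈ P
      α∈ = evenProducts ts ts≢ even′ α (λ _ → refl)

      go : Dec (j ≡ k) → z ∈ P
      go (yes refl) = adjacentTranspositions α z i≢j k≢l α∈ p
      go (no j≢k) = adjacentTranspositions β z i≢j j≢k β∈
        (λ x → trans (cong (λ x → eval ts ⟨$⟩ʳ PC.transpose k l x)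
          (transpose-involutive j k (PC.transpose i j x))) (p x))
        where
        β : A.Carrier n
        β = eval ((j , k) ∷ (k , l) ∷ ts) , _ , j≢k ∷ k≢l ∷ ts≢ , even , λ _ → refl
        β∈ : β ∈ P
        β∈ = adjacentTranspositions α β j≢k k≢l α∈ (λ _ → refl)

  generatedByThreeCycles : ∀ z → z ∈ P
  generatedByThreeCycles z@(_ , ts , ts≢ , even , p) = evenProducts ts ts≢ even z p

module Stabiliser (5≤n : 5 ≤ n) (f : SymA.Carrier n) (f-auto : f ∈ IsAutomorphism (CAG n))
  (f-ε : A._≈_ n (Inverse.to f (A.ε n)) (A.ε n)) where

  open Inverse f using (to; from; to-cong; from-cong; strictlyInverseˡ; strictlyInverseʳ)

  V : Set
  V = ∃ (ThreeCycles n)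

  abstract
    to-adj : ∀ α β → Adj (proj₁ α) (proj₁ β) → Adj (proj₁ (to α)) (proj₁ (to β))
    to-adj α β (υ , u , p) =
      let (τ , _) , t , q = Equivalence.to (f-auto α β) ((υ , IsThreeCycle⊆Even u) , u , p)
      in τ , t , q

    to-adj⁻ : ∀ α β → Adj (proj₁ (to α)) (proj₁ (to β)) → Adj (proj₁ α) (proj₁ β)
    to-adj⁻ α β (υ , u , p) =
      let (τ , _) , t , q = Equivalence.from (f-auto α β) ((υ , IsThreeCycle⊆Even u) , u , p)
      in τ , t , q

    to-threeCycle : ∀ α → IsThreeCycle (proj₁ α) → IsThreeCycle (proj₁ (to α))
    to-threeCycle α s =
      let τ , t , q = to-adj (A.ε n) α (proj₁ α , s , λ _ → refl)
      in IsThreeCycle-resp (λ x → sym (trans (q x) (f-ε _))) t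

    to-threeCycle⁻ : ∀ α → IsThreeCycle (proj₁ (to α)) → IsThreeCycle (proj₁ α)
    to-threeCycle⁻ α s =
      let τ , t , q = to-adj⁻ (A.ε n) α (proj₁ (to α) , s , λ _ → sym (f-ε _))
      in IsThreeCycle-resp (λ x → sym (q x)) t

    to-surjective : IsThreeCycle σ → ∃[ v ] proj₁ (to (proj₁ {B = ThreeCycles n} v)) Perm.≈ σ
    to-surjective {σ = σ} s =
      (α , to-threeCycle⁻ α (IsThreeCycle-resp (λ x → sym (strictlyInverseˡ β x)) s)) ,
      strictlyInverseˡ β
      where
      β α : A.Carrier n
      β = σ , IsThreeCycle⊆Even s
      α = from β

    to-injective : ∀ α β → proj₁ (to α) Perm.≈ proj₁ (to β) → proj₁ α Perm.≈ proj₁ β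
    to-injective α β p x = trans (sym (strictlyInverseʳ α x))
      (trans (from-cong {to α} {to β} p x) (strictlyInverseʳ β x))

  open Neighbourhood 5≤n {V} (proj₁ ∘ proj₁) (proj₁ ∘ to ∘ proj₁) proj₂
    (λ (α , s) → to-threeCycle α s)
    (λ s → ((_ , IsThreeCycle⊆Even s) , s) , λ _ → refl) to-surjective
    (λ (α , _) (β , _) → to-cong {α} {β}) (λ (α , _) (β , _) → to-injective α β)
    (λ (α , _) (β , _) → to-adj α β) (λ (α , _) (β , _) → to-adj⁻ α β)
    public

translate : SymA.Carrier n → A.Carrier n → SymA.Carrier n
translate {n} f γ = SymA._∙_ n (SymA._∙_ n ρ f) (SymA._⁻¹ n ρ)
  where
  ρ : SymA.Carrier n
  ρ = rightMultiplication (A n) γ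

Fixes : SymA.Carrier n → A.Carrier n → Set
Fixes {n} f α = A._≈_ n (Inverse.to f α) α

FixesThreeCycles : SymA.Carrier n → Set
FixesThreeCycles {n} f = ∀ α → α ∈ ThreeCycles n → Fixes f α

module _ {n} (f : SymA.Carrier n) (f-auto : f ∈ IsAutomorphism (CAG n)) where
  open A n hiding (refl; sym; trans)
  open GroupProperties (A n)

  translate-isAutomorphism : ∀ γ → translate f γ ∈ IsAutomorphism (CAG n)
  translate-isAutomorphism γ = ∙-closed {SymA._∙_ n ρ f} {SymA._⁻¹ n ρ}
    (∙-closed {ρ} {f} ρ-auto f-auto) (⁻¹-closed {ρ} ρ-auto)
    where
    open IsSubgroup (IsAutomorphism-isSubgroup (CAG n))
    ρ : SymA.Carrier n
    ρ = rightMultiplication (A n) γ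
    ρ-auto : ρ ∈ IsAutomorphism (CAG n)
    ρ-auto = rightMultiplication-isAutomorphism (A n) (ThreeCycles-isConnectionSet n) γ

  translate-fixes : ∀ {α} γ → Fixes f (α ∙ γ) → Fixes (translate f γ) α
  translate-fixes {α} γ p = A.trans n {Inverse.to f (α ∙ γ) ∙ γ ⁻¹} {α ∙ γ ∙ γ ⁻¹} {α}
    (∙-congʳ {γ ⁻¹} {Inverse.to f (α ∙ γ)} {α ∙ γ} p) (//-rightDividesʳ γ α)

  translate-fixes⁻ : ∀ {α} γ → Fixes (translate f γ) α → Fixes f (α ∙ γ)
  translate-fixes⁻ {α} γ p = A.trans n {fαγ} {fαγ ∙ γ ⁻¹ ∙ γ} {α ∙ γ}
    (A.sym n {fαγ ∙ γ ⁻¹ ∙ γ} {fαγ} (//-rightDividesˡ γ fαγ)) (∙-congʳ {γ} {fαγ ∙ γ ⁻¹} {α} p)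
    where
    fαγ : Carrier
    fαγ = Inverse.to f (α ∙ γ)

  Fixes-resp : (Fixes f) Respects _≈_
  Fixes-resp {α} {β} α≈β p = A.trans n {Inverse.to f β} {Inverse.to f α} {β}
    (Inverse.to-cong f {β} {α} (A.sym n {α} {β} α≈β))
    (A.trans n {Inverse.to f α} {α} {β} p α≈β)

  module Step (5≤n : 5 ≤ n) (f-ε : Fixes f ε) (f-fixes : FixesThreeCycles f)
    (γ : A.Carrier n) (γ∈ : γ ∈ ThreeCycles n) where

    F : SymA.Carrier n
    F = translate f γ

    F-auto : F ∈ IsAutomorphism (CAG n)
    F-auto = translate-isAutomorphism γ

    F-ε : Fixes F ε
    F-ε = translate-fixes {ε} γ
      (Fixes-resp {γ} {ε ∙ γ} (A.sym n {ε ∙ γ} {γ} (identityˡ γ)) (f-fixes γ γ∈))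

    module N = Stabiliser {n} 5≤n F F-auto F-ε

    -- For α sharing an arc with γ⁻¹, the product α ∙ γ is ε or a 3-cycle, so f fixes it.
    near : Cycle (Perm.flip (proj₁ γ)) p q r →
      ∀ v → Cycle (proj₁ (proj₁ {B = ThreeCycles n} v)) p q x → Fixes F (proj₁ v)
    near {p} {q} {r} {x} S (α , _) T = translate-fixes {α} γ (go (r ≟ x))
      where
      go : Dec (r ≡ x) → Fixes f (α ∙ γ)
      go (yes refl) = Fixes-resp {ε} {α ∙ γ}
        (λ y → trans (sym (Perm.inverseʳ (proj₁ γ))) (cong (proj₁ γ ⟨$⟩ʳ_) (Cycle-unique S T y)))
        f-ε
      go (no r≢x) =
        let υ , u , p = share⇒adj S T r≢x
            β = υ , IsThreeCycle⊆Even u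
        in Fixes-resp {β} {α ∙ γ}
             (λ y → trans (sym (Perm.inverseʳ (proj₁ γ))) (cong (proj₁ γ ⟨$⟩ʳ_) (sym (p y))))
             (f-fixes β u)

    nearArc : Cycle (Perm.flip (proj₁ γ)) p q r → N.Arc p q p q
    nearArc S = N.arc (a≢b S) (a≢b S) (λ v T → trans (near S v T _) (a↦b T))

    arc-fixed : ∀ {p′ q′} → Cycle (Perm.flip (proj₁ γ)) p q r → N.Arc p q p′ q′ → p′ ≡ p × q′ ≡ q
    arc-fixed S G = N.arc-unique G (nearArc S)

    along⇒id : ∀ {π} → Cycle (Perm.flip (proj₁ γ)) a b c → N.Along π → ∀ x → π ⟨$⟩ʳ x ≡ x
    along⇒id {a} {b} {c} {π} S F x = go (position a b c x)
      where
      go : Position a b c x → π ⟨$⟩ʳ x ≡ x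
      go 1st = proj₁ (arc-fixed S (F (a≢b S)))
      go 2nd = proj₂ (arc-fixed S (F (a≢b S)))
      go 3rd = proj₂ (arc-fixed (rotate S) (F (b≢c S)))
      go (other x≢a x≢b _) = third (N.permCycle (a≢b S) (≢-sym x≢b) x≢a)
        where
        third : ∃[ v ] Cycle (proj₁ (proj₁ {B = ThreeCycles n} v)) a b x → π ⟨$⟩ʳ x ≡ x
        third (v , T) = trans (sym (b↦c (N.along-Cycle {π = π} F v T)))
          (trans (cong (proj₁ (Inverse.to (translate f γ) (proj₁ v)) ⟨$⟩ʳ_)
            (proj₂ (arc-fixed S (F (a≢b S))))) (trans (near S v T b) (b↦c T)))

    ¬against : ∀ {π} → Cycle (Perm.flip (proj₁ γ)) a b c → ¬ N.Against π
    ¬against S F = c≢a S (trans (sym (proj₂ (arc-fixed (rotate S) (F (b≢c S)))))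
      (proj₁ (arc-fixed S (F (a≢b S)))))

    translate-fixesThreeCycles : FixesThreeCycles F
    translate-fixesThreeCycles α α∈ =
      let _ , _ , _ , S = IsThreeCycle⇒Cycle γ∈ in go (Cycle-flip S) N.classification
      where
      go : Cycle (Perm.flip (proj₁ γ)) a b c → ∃[ π ] (N.Along π ⊎ N.Against π) → Fixes F α
      go S (π , inj₂ against) = ⊥-elim (¬against {π = π} S against)
      go S (π , inj₁ along) =
        let i , j , k , T = IsThreeCycle⇒Cycle α∈
        in Cycle-unique (subst-Cycle (along⇒id {π = π} S along i) (along⇒id {π = π} S along j)
             (along⇒id {π = π} S along k) (N.along-Cycle {π = π} along (α , α∈) T)) T

module _ {n} (5≤n : 5 ≤ n) (f : SymA.Carrier n) (f-auto : f ∈ IsAutomorphism (CAG n))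
  (f-ε : Fixes f (A.ε n)) (f-fixes : FixesThreeCycles f) where
  open A n hiding (refl; sym; trans)

  private
    Good : Pred Carrier _
    Good γ = Fixes f γ × (∀ α → α ∈ ThreeCycles n → Fixes f (α ∙ γ))

    resp : (Fixes f) Respects _≈_
    resp {α} {β} = Fixes-resp f f-auto {α} {β}

    Good-resp : Good Respects _≈_
    Good-resp {β} {γ} β≈γ (p , q) = resp {β} {γ} β≈γ p ,
      λ α α∈ → resp {α ∙ β} {α ∙ γ} (∙-congˡ {α} {β} {γ} β≈γ) (q α α∈)

    Good-ε : Good ε
    Good-ε = f-ε , λ α α∈ → resp {α} {α ∙ ε} (A.sym n {α ∙ ε} {α} (identityʳ α)) (f-fixes α α∈)

    Good-∙ : ∀ σ γ → σ ∈ ThreeCycles n → γ ∈ Good → σ ∙ γ ∈ Good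
    Good-∙ σ γ σ∈ (p , q) = q σ σ∈ , λ α α∈ → resp {α ∙ σ ∙ γ} {α ∙ (σ ∙ γ)} (assoc α σ γ)
      (translate-fixes⁻ f f-auto {α ∙ σ} γ
        (translate-fixes⁻ f′ f′-auto {α} σ (T.translate-fixesThreeCycles α α∈)))
      where
      f′ : SymA.Carrier n
      f′ = translate f γ
      f′-auto : f′ ∈ IsAutomorphism (CAG n)
      f′-auto = translate-isAutomorphism f f-auto γ
      f′-ε : Fixes f′ ε
      f′-ε = translate-fixes f f-auto {ε} γ
        (resp {γ} {ε ∙ γ} (A.sym n {ε ∙ γ} {γ} (identityˡ γ)) p)
      module T = Step f′ f′-auto 5≤n f′-ε
        (λ α α∈ → translate-fixes f f-auto {α} γ (q α α∈)) σ σ∈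

  rigid : ∀ α → Fixes f α
  rigid α = proj₁ (generatedByThreeCycles {P = Good}
    (λ {β} {γ} → Good-resp {β} {γ}) Good-ε Good-∙ α)

-- The automorphism group

module S n = Group (S n)

conjugationA : S.Carrier n → SymA.Carrier n
conjugationA {n} g = record
  { to        = λ (σ , σ∈) → to σ , Even-normal (Perm.flip g) {σ} σ∈
  ; from      = λ (σ , σ∈) → from σ , Even-normal g {σ} σ∈
  ; to-cong   = λ {α} {β} → to-cong {proj₁ α} {proj₁ β}
  ; from-cong = λ {α} {β} → from-cong {proj₁ α} {proj₁ β}
  ; inverse   = (λ {α} {β} → proj₁ inverse {proj₁ α} {proj₁ β})
              , (λ {α} {β} → proj₂ inverse {proj₁ α} {proj₁ β})
  }
  where
  open Inverse (conjugationBy (S n) g)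

abstract
  preserves⇒isAutomorphism : (f : SymA.Carrier n) →
    (∀ α β → Graph.Adjacent (CAG n) α β →
      Graph.Adjacent (CAG n) (Inverse.to f α) (Inverse.to f β)) →
    (∀ α β → Graph.Adjacent (CAG n) α β →
      Graph.Adjacent (CAG n) (Inverse.from f α) (Inverse.from f β)) →
    f ∈ IsAutomorphism (CAG n)
  preserves⇒isAutomorphism {n} f p q α β = mk⇔ (p α β) λ adj →
    proj₂ resp {β} {from (to α)} {α} (strictlyInverseʳ α)
      (proj₁ resp {from (to α)} {from (to β)} {β} (strictlyInverseʳ β)
        (q (to α) (to β) adj))
    where
    open Graph (CAG n)
    open Inverse f

  conjugationA-preserves : ∀ (g : S.Carrier n) α β → Graph.Adjacent (CAG n) α β →
    Graph.Adjacent (CAG n) (Inverse.to (conjugationA g) α) (Inverse.to (conjugationA g) β)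
  conjugationA-preserves g α β (τ , t , p) = Inverse.to (conjugationA g) τ ,
    Cycle⇒IsThreeCycle (Cycle-conjugate g (proj₂ (proj₂ (proj₂ (IsThreeCycle⇒Cycle t))))) ,
    λ x → cong (g ⟨$⟩ʳ_) (trans (p (g ⟨$⟩ˡ x)) (cong (proj₁ α ⟨$⟩ʳ_) (sym (Perm.inverseˡ g))))

  conjugationA-isAutomorphism : (g : S.Carrier n) → conjugationA g ∈ IsAutomorphism (CAG n)
  conjugationA-isAutomorphism g = preserves⇒isAutomorphism (conjugationA g)
    (conjugationA-preserves g) (conjugationA-preserves (Perm.flip g))

  inversion-preserves : ∀ α β → Graph.Adjacent (CAG n) α β →
    Graph.Adjacent (CAG n) (A._⁻¹ n α) (A._⁻¹ n β)
  inversion-preserves {n} α β (τ , t , p) = Inverse.to (conjugationA (proj₁ α)) (A._⁻¹ n τ) ,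
    Cycle⇒IsThreeCycle (Cycle-conjugate (proj₁ α)
      (Cycle-flip (proj₂ (proj₂ (proj₂ (IsThreeCycle⇒Cycle t)))))) ,
    λ x → trans (⟨$⟩ˡ-unique (proj₁ β) (trans (p (proj₁ τ ⟨$⟩ˡ (proj₁ α ⟨$⟩ˡ x)))
      (trans (cong (proj₁ α ⟨$⟩ʳ_) (Perm.inverseʳ (proj₁ τ))) (Perm.inverseʳ (proj₁ α)))))
      (sym (Perm.inverseˡ (proj₁ α)))

  inversion-isAutomorphism : inversion (A n) ∈ IsAutomorphism (CAG n)
  inversion-isAutomorphism {n} =
    preserves⇒isAutomorphism (inversion (A n)) inversion-preserves inversion-preserves

module _ (n : ℕ) (5≤n : 5 ≤ n) where

  private
    module An = Group (A n)
    module Sn = Group (S n)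
    module G = Group (SymA n)

    vertex : Fin n
    vertex = fromℕ< (≤-trans (s≤s z≤n) 5≤n)

    ρ : An.Carrier → G.Carrier
    ρ = rightMultiplication (A n)

    κ : Sn.Carrier → G.Carrier
    κ = conjugationA

    h : G.Carrier
    h = inversion (A n)

  threeCycleAt : a ≢ b → b ≢ c → c ≢ a → ∃[ α ] Cycle (proj₁ {B = Even {n}} α) a b c
  threeCycleAt a≢b b≢c c≢a =
    let C = transpose²-cycle (≢-sym c≢a) (≢-sym b≢c) (≢-sym a≢b)
    in (_ , IsThreeCycle⊆Even (Cycle⇒IsThreeCycle C)) , C

  abstract
    centralizer-trivial : (k : Sn.Carrier) →
      (∀ (α : An.Carrier) x → proj₁ α ⟨$⟩ʳ (k ⟨$⟩ʳ x) ≡ k ⟨$⟩ʳ (proj₁ α ⟨$⟩ʳ x)) →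
      ∀ x → k ⟨$⟩ʳ x ≡ x
    centralizer-trivial k commutes a = go (k ⟨$⟩ʳ a ≟ a)
      where
      go : Dec (k ⟨$⟩ʳ a ≡ a) → k ⟨$⟩ʳ a ≡ a
      go (yes p) = p
      go (no ka≢a) =
        let c , c≢a , c≢ka , _ = fresh 5≤n a (k ⟨$⟩ʳ a) a a
            d , d≢a , d≢ka , d≢c , _ = fresh 5≤n a (k ⟨$⟩ʳ a) c c
            α , C = threeCycleAt (≢-sym c≢a) (≢-sym d≢c) d≢a
        in contradiction (⟨$⟩ʳ-injective k
             (trans (sym (trans (commutes α a) (cong (k ⟨$⟩ʳ_) (a↦b C))))
               (fixes C (k ⟨$⟩ʳ a) ka≢a (≢-sym c≢ka) (≢-sym d≢ka)))) c≢a

    κ-injective : ∀ {g k} → κ g G.≈ κ k → g Sn.≈ k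
    κ-injective {g} {k} p x = trans (sym (Perm.inverseʳ k))
      (cong (k ⟨$⟩ʳ_) (centralizer-trivial (g Sn.∙ k Sn.⁻¹) commutes x))
      where
      commutes : ∀ (α : An.Carrier) x →
        proj₁ α ⟨$⟩ʳ (k ⟨$⟩ˡ (g ⟨$⟩ʳ x)) ≡ k ⟨$⟩ˡ (g ⟨$⟩ʳ (proj₁ α ⟨$⟩ʳ x))
      commutes α x = trans (sym (⟨$⟩ˡ-unique k (sym (p α (g ⟨$⟩ʳ x)))))
        (cong (λ y → k ⟨$⟩ˡ (g ⟨$⟩ʳ (proj₁ α ⟨$⟩ʳ y))) (Perm.inverseˡ g))

  ρ-monomorphism : MagmaMono (A n) (SymA n) ρ
  ρ-monomorphism = record
    { isMagmaHomomorphism = record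
      { isRelHomomorphism = record { cong = λ x≈y α i → x≈y (proj₁ α ⟨$⟩ʳ i) }
      ; homo = λ x y α i → refl
      }
    ; injective = λ p → p An.ε
    }

  κ-monomorphism : MagmaMono (S n) (SymA n) κ
  κ-monomorphism = record
    { isMagmaHomomorphism = record
      { isRelHomomorphism = record
        { cong = λ {g} {k} g≈k α → Sn.∙-cong {g Sn.⁻¹ Sn.∙ proj₁ α} {k Sn.⁻¹ Sn.∙ proj₁ α} {g} {k}
            (Sn.∙-congʳ {proj₁ α} {g Sn.⁻¹} {k Sn.⁻¹} (Sn.⁻¹-cong {g} {k} g≈k)) g≈k }
      ; homo = λ g k α i → refl
      }
    ; injective = λ {g} {k} → κ-injective {g} {k}
    }

  conj : Action (S n) (A n)
  conj = conjugation (S n) Even-isSubgroup Even-normal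

  module RI = SemidirectEmbedding (A n) (S n) conj (SymA n) ρ-monomorphism κ-monomorphism
    (λ g x α i → sym (Perm.inverseʳ g))
    (λ {x} {g} p → λ i → trans (p An.ε i) (Perm.inverseʳ g))

  ζ : Parity → G.Carrier
  ζ 0ℙ = G.ε
  ζ 1ℙ = h

  abstract
    someThreeCycle : ∃[ α ] ∃[ a ] ∃[ b ] ∃[ c ] Cycle (proj₁ {B = Even {n}} α) a b c
    someThreeCycle =
      let b , b≢a , _ = fresh 5≤n vertex vertex vertex vertex
          c , c≢a , c≢b , _ = fresh 5≤n vertex b b b
          α , C = threeCycleAt (≢-sym b≢a) (≢-sym c≢b) c≢a
      in α , _ , _ , _ , C

    inversion≉ε : ¬ (h G.≈ G.ε)
    inversion≉ε p =
      let α , a , b , c , C = someThreeCycle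
      in b≢c C (trans (sym (trans (p α a) (a↦b C))) (⟨$⟩ˡ-unique (proj₁ α) (c↦a C)))

    -- Otherwise inversion would be a homomorphism, and A n commutative.
    κ-≉-inversion : ∀ g → ¬ (κ g G.≈ h)
    κ-≉-inversion g p =
      let b , b≢a , _ = fresh 5≤n vertex vertex vertex vertex
          c , c≢a , c≢b , _ = fresh 5≤n vertex b b b
          d , d≢a , d≢b , d≢c , _ = fresh 5≤n vertex b c c
          α , C = threeCycleAt (≢-sym b≢a) (≢-sym c≢b) c≢a
          β , D = threeCycleAt (≢-sym b≢a) (≢-sym d≢b) d≢a
      in d≢c (trans
           (sym (trans (cong (proj₁ β ⟨$⟩ˡ_) (a↦b (Cycle-flip C))) (b↦c (Cycle-flip D))))
           (trans (commutes α β b)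
             (trans (cong (proj₁ α ⟨$⟩ˡ_) (a↦b (Cycle-flip D))) (b↦c (Cycle-flip C)))))
      where
      commutes : ∀ (α β : An.Carrier) i →
        proj₁ β ⟨$⟩ˡ (proj₁ α ⟨$⟩ˡ i) ≡ proj₁ α ⟨$⟩ˡ (proj₁ β ⟨$⟩ˡ i)
      commutes α β i = sym (trans (sym (p (α An.∙ β) i))
        (trans (cong (λ j → g ⟨$⟩ʳ (proj₁ β ⟨$⟩ʳ j)) (sym (Perm.inverseˡ g)))
          (trans (cong (λ j → g ⟨$⟩ʳ (proj₁ β ⟨$⟩ʳ (g ⟨$⟩ˡ j))) (p α i)) (p β _))))

  ζ-monomorphism : MagmaMono ℤ₂ (SymA n) ζ
  ζ-monomorphism = record
    { isMagmaHomomorphism = record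
      { isRelHomomorphism = record { cong = λ { {x} refl → G.refl {ζ x} } }
      ; homo = λ { 0ℙ y → G.refl {ζ y} ; 1ℙ 0ℙ → G.refl {h}
                 ; 1ℙ 1ℙ → λ α i → sym (GroupProperties.⁻¹-involutive (A n) α i) }
      }
    ; injective = λ { {0ℙ} {0ℙ} _ → refl
                    ; {0ℙ} {1ℙ} p → contradiction (G.sym {G.ε} {h} p) inversion≉ε
                    ; {1ℙ} {0ℙ} p → contradiction p inversion≉ε
                    ; {1ℙ} {1ℙ} _ → refl }
    }

  twist : Action ℤ₂ (A⋊S n)
  twist = inversionAction (S n) Even-isSubgroup Even-normal

  abstract
    ζ-compatible : ∀ k u → ζ k G.∙ RI.⟦ u ⟧ G.≈ RI.⟦ Action._▷_ twist k u ⟧ G.∙ ζ k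
    ζ-compatible 0ℙ u = G.refl {RI.⟦ u ⟧}
    ζ-compatible 1ℙ ((x , _) , g) α i =
      cong (λ j → g ⟨$⟩ʳ (x ⟨$⟩ʳ (proj₁ α ⟨$⟩ˡ j))) (sym (Perm.inverseʳ x))

    ζ-disjoint : ∀ {u k} → RI.⟦ u ⟧ G.≈ ζ k → Group._≈_ (A⋊S n) u (Group.ε (A⋊S n))
    ζ-disjoint {u} {0ℙ} p = RI.⟦⟧-trivialKernel {proj₁ u} {proj₂ u} p
    ζ-disjoint {(x , x∈) , g} {1ℙ} p = contradiction κ≈h (κ-≉-inversion g)
      where
      x≈ε : ∀ i → x ⟨$⟩ʳ i ≡ i
      x≈ε i = ⟨$⟩ʳ-injective g (trans (cong (λ j → g ⟨$⟩ʳ (x ⟨$⟩ʳ j)) (sym (Perm.inverseˡ g)))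
        (p An.ε (g ⟨$⟩ʳ i)))
      κ≈h : κ g G.≈ h
      κ≈h α i = trans (cong (g ⟨$⟩ʳ_) (sym (x≈ε _))) (p α i)

  module Full = SemidirectEmbedding (A⋊S n) ℤ₂ twist (SymA n) RI.⟦⟧-monomorphism ζ-monomorphism
    ζ-compatible (λ {u} {k} → ζ-disjoint {u} {k})

  RightRegular≐ : RightRegular (A n) ≐ Image (A n) (SymA n) ρ
  RightRegular≐ = (λ r → r) , (λ r → r)

  InnS≐ : InnS n ≐ Image (S n) (SymA n) κ
  InnS≐ =
      (λ (φ , (g , φ≈) , p) → g , λ α i → trans (p α i) (φ≈ (proj₁ α) i))
    , (λ (g , p) → conjugationBy (S n) g , (g , λ σ i → refl) , p)

  RI≐ : _·_ (SymA n) (RightRegular (A n)) (InnS n) ≐ Image (A⋊S n) (SymA n) RI.⟦_⟧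
  RI≐ =
      (λ {f} (r , i , (x , r≈) , i∈ , f≈) → let g , i≈ = proj₁ InnS≐ {i} i∈ in
        (x , g) , G.trans {f} {r G.∙ i} {ρ x G.∙ κ g} f≈ (G.∙-cong {r} {ρ x} {i} {κ g} r≈ i≈))
    , (λ ((x , g) , f≈) →
        ρ x , κ g , (x , G.refl {ρ x}) , proj₂ InnS≐ {κ g} (g , G.refl {κ g}) , f≈)

  ⟨h⟩≐ : ⟨_⟩ (SymA n) h ≐ Image ℤ₂ (SymA n) ζ
  ⟨h⟩≐ = ⊆ , λ { (0ℙ , p) → respect (λ α i → sym (p α i)) unit
               ; (1ℙ , p) → respect (λ α i → sym (p α i)) generator }
    where
    open IsSubgroup (isSubgroup-Image ℤ₂ (SymA n)
      (IsMagmaMonomorphism.isMagmaHomomorphism ζ-monomorphism) ((λ z → z) , (λ z → z)))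
    ⊆ : ∀ {f} → ⟨_⟩ (SymA n) h f → Image ℤ₂ (SymA n) ζ f
    ⊆ generator             = 1ℙ , G.refl {h}
    ⊆ unit                  = ε-closed
    ⊆ (product {x} {y} p q) = ∙-closed {x} {y} (⊆ p) (⊆ q)
    ⊆ (invert {x} p)        = ⁻¹-closed {x} (⊆ p)
    ⊆ (respect {x} {y} e p) = resp {x} {y} e (⊆ p)

  private
    Im : Pred G.Carrier _
    Im = Image ([A⋊S]⋊ℤ₂ n) (SymA n) Full.⟦_⟧

    module Im = IsSubgroup (isSubgroup-Image ([A⋊S]⋊ℤ₂ n) (SymA n) Full.⟦⟧-homomorphism {K = Im}
      ((λ z → z) , (λ z → z)))
    module Au = IsSubgroup (IsAutomorphism-isSubgroup (CAG n))

    ρ-auto : ∀ x → ρ x ∈ IsAutomorphism (CAG n)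
    ρ-auto = rightMultiplication-isAutomorphism (A n) (ThreeCycles-isConnectionSet n)

    ζ-auto : ∀ k → ζ k ∈ IsAutomorphism (CAG n)
    ζ-auto 0ℙ = Au.ε-closed
    ζ-auto 1ℙ = inversion-isAutomorphism

    ρ∈Im : ∀ x → Im (ρ x)
    ρ∈Im x = ((x , Sn.ε) , 0ℙ) , λ α i → refl

    κ∈Im : ∀ g → Im (κ g)
    κ∈Im g = ((An.ε , g) , 0ℙ) , λ α i → refl

    h∈Im : Im h
    h∈Im = ((An.ε , Sn.ε) , 1ℙ) , λ α i → refl

    cancel : ∀ f g → Im (f G.∙ g G.⁻¹) → Im g → Im f
    cancel f g p q = Im.resp {f G.∙ g G.⁻¹ G.∙ g} {f}
      (GroupProperties.//-rightDividesˡ (SymA n) g f)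
      (Im.∙-closed {f G.∙ g G.⁻¹} {g} p q)

    agree : ∀ f g → f ∈ IsAutomorphism (CAG n) → g ∈ IsAutomorphism (CAG n) →
      Fixes f An.ε → Fixes g An.ε → Im g →
      (∀ α → α ∈ ThreeCycles n → Inverse.to f α An.≈ Inverse.to g α) → Im f
    agree f g f-auto g-auto f-ε g-ε g∈ p = cancel f g
      (Im.resp {G.ε} {f G.∙ g G.⁻¹} (λ α i → sym (f/g≈ε α i)) Im.ε-closed) g∈
      where
      quotient-fixes : ∀ α → Inverse.to f α An.≈ Inverse.to g α → Fixes (f G.∙ g G.⁻¹) α
      quotient-fixes α q i = trans (Inverse.from-cong g {Inverse.to f α} {Inverse.to g α} q i)
        (Inverse.strictlyInverseʳ g α i)
      f/g≈ε : ∀ α → Fixes (f G.∙ g G.⁻¹) α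
      f/g≈ε = rigid 5≤n (f G.∙ g G.⁻¹)
        (Au.∙-closed {f} {g G.⁻¹} f-auto (Au.⁻¹-closed {g} g-auto))
        (quotient-fixes An.ε (λ i → trans (f-ε i) (sym (g-ε i))))
        (λ α α∈ → quotient-fixes α (p α α∈))

    stabiliser⊆Im : ∀ f → f ∈ IsAutomorphism (CAG n) → Fixes f An.ε → Im f
    stabiliser⊆Im f f-auto f-ε = go N.classification
      where
      module N = Stabiliser 5≤n f f-auto f-ε
      go : ∃[ π ] (N.Along π ⊎ N.Against π) → Im f
      go (π , inj₁ along) = agree f (κ π) f-auto (conjugationA-isAutomorphism π) f-ε
        (λ i → Perm.inverseʳ π) (κ∈Im π)
        (λ α α∈ → let _ , _ , _ , C = IsThreeCycle⇒Cycle α∈ in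
          Cycle-unique (N.along-Cycle {π = π} along (α , α∈) C) (Cycle-conjugate π C))
      go (π , inj₂ against) = agree f (h G.∙ κ π) f-auto
        (Au.∙-closed {h} {κ π} inversion-isAutomorphism (conjugationA-isAutomorphism π)) f-ε
        (λ i → Perm.inverseʳ π) (Im.∙-closed {h} {κ π} h∈Im (κ∈Im π))
        (λ α α∈ → let _ , _ , _ , C = IsThreeCycle⇒Cycle α∈ in
          Cycle-unique (N.against-Cycle {π = π} against (α , α∈) C)
            (Cycle-conjugate π (rotate (rotate (Cycle-flip C)))))

  Automorphisms≐ : IsAutomorphism (CAG n) ≐ Image ([A⋊S]⋊ℤ₂ n) (SymA n) Full.⟦_⟧
  Automorphisms≐ = (λ {f} → ⊆ f) , λ {f} → ⊇ f
    where
    ⊆ : ∀ f → f ∈ IsAutomorphism (CAG n) → Im f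
    ⊆ f f-auto = cancel f (ρ γ) (stabiliser⊆Im (f G.∙ ρ γ G.⁻¹)
      (Au.∙-closed {f} {ρ γ G.⁻¹} f-auto (Au.⁻¹-closed {ρ γ} (ρ-auto γ))) (An.inverseʳ γ))
      (ρ∈Im γ)
      where
      γ : An.Carrier
      γ = Inverse.to f An.ε
    ⊇ : ∀ f → Im f → f ∈ IsAutomorphism (CAG n)
    ⊇ f (((x , g) , k) , p) = Au.resp {ρ x G.∙ κ g G.∙ ζ k} {f} (λ α i → sym (p α i))
      (Au.∙-closed {ρ x G.∙ κ g} {ζ k}
        (Au.∙-closed {ρ x} {κ g} (ρ-auto x) (conjugationA-isAutomorphism g)) (ζ-auto k))

theorem3p1 : (n : ℕ) → 5 ≤ n →
    let R   = RightRegular (A n)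
        I   = InnS n
        RI  = _·_ (SymA n) R I
        h   = inversion (A n)
        ⟨h⟩ = ⟨_⟩ (SymA n) h
    in IsInternalSemidirectProduct (SymA n) RI R I
     × IsInternalSemidirectProduct (SymA n) (IsAutomorphism (CAG n)) RI ⟨h⟩
     × subgroup (SymA n) (⟨⟩-isSubgroup (SymA n) h) ≅ ℤ₂
     × Aut (CAG n) ≅ [A⋊S]⋊ℤ₂ n
theorem3p1 n 5≤n =
    RI.isInternalSemidirectProduct n 5≤n (RI≐ n 5≤n) (RightRegular≐ n 5≤n) (InnS≐ n 5≤n)
  , Full.isInternalSemidirectProduct n 5≤n (Automorphisms≐ n 5≤n) (RI≐ n 5≤n) (⟨h⟩≐ n 5≤n)
  , subgroup≅ ℤ₂ (SymA n) (ζ-monomorphism n 5≤n) (⟨⟩-isSubgroup (SymA n) (inversion (A n)))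
      (⟨h⟩≐ n 5≤n)
  , subgroup≅ ([A⋊S]⋊ℤ₂ n) (SymA n) (Full.⟦⟧-monomorphism n 5≤n)
      (IsAutomorphism-isSubgroup (CAG n)) (Automorphisms≐ n 5≤n)
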